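{- Let $a$ be a positive integer, let $r$ be the largest integer such that $r^2\mid a$, and let $\delta\in(0,\frac12)$ be real. Then \[ A(a,\delta)\ll \delta a(\log a)\,d(a)+\sigma(r), \] where the implied constant is absolute.
   Context: For real $t$, $\|t\|=\min_{n\in\mathbb{Z}}|t-n|$ is the distance from $t$ to the nearest integer. For a positive integer $a$ and real $\delta>0$, $A(a,\delta)$ is the number of integers $x$ with $1\le x\le a$ and $\left\|\frac{x^2}{a}\right\|\le\delta$. For a positive integer $n$, $d(n)=\sum_{m\mid n}1$ is the number of positive divisors of $n$ and $\sigma(n)=\sum_{m\mid n}m$ is their sum. $\log$ is the natural logarithm. The notation $f\ll g$ means that there is a constant $C$ with $|f|\le C|g|$ for all admissible values of the parameters (here $a$ and $\delta$). -}

module Defs where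

open import Data.Empty using (⊥-elim)
open import Data.Integer.Base as ℤ using (ℤ; +_)
import Data.Integer.DivMod as ℤ
import Data.Integer.Properties as ℤ
open import Data.List.Base using (List; []; _∷_; length; filter; applyUpTo)
open import Data.List.Membership.Propositional using (_∈_)
open import Data.List.Membership.Propositional.Properties using (∈-applyUpTo⁺)
import Data.List.Relation.Unary.All as All
open import Data.List.Relation.Unary.AllPairs using ([]; _∷_)
open import Data.List.Relation.Unary.Any using (here; there)
open import Data.List.Relation.Unary.Unique.Propositional using (Unique)
open import Data.List.Relation.Unary.Unique.Propositional.Properties using (applyUpTo⁺₁)
open import Data.Nat.Base as ℕ using (ℕ; zero; suc; NonZero)
open import Data.Nat.Divisibility using (_∣?_) renaming (_∣_ to _divides_)
open import Data.Nat.ListAction using (sum)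
import Data.Nat.Properties as ℕ
open import Data.Product using (∃; ∃-syntax; _×_; _,_; proj₁; proj₂)
open import Data.Rational.Base as ℚ using (ℚ; 0ℚ; 1ℚ; mkℚ; *≤*; *<*)
import Data.Rational.Properties as ℚ
open import Data.Rational.Solver using (module +-*-Solver)
import Data.Rational.Unnormalised.Base as ℚᵘ
import Data.Rational.Unnormalised.Properties as ℚᵘ
open import Data.Sum.Base using (inj₁; inj₂)
open import Function.Bundles using (_⇔_; mk⇔; Equivalence)
open import Relation.Binary.PropositionalEquality
open import Relation.Nullary using (¬_; yes; no)

module Rat where
  open import Data.Rational.Base using (_+_; _*_; _-_; -_; _≤_; _<_; ∣_∣; _/_)
  open +-*-Solver using (solve; _:+_; _:*_; _:-_; :-_; _:=_; con)

  ∣p-q∣≡∣q-p∣ : ∀ p q → ∣ p - q ∣ ≡ ∣ q - p ∣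
  ∣p-q∣≡∣q-p∣ p q = trans (cong ∣_∣ (solve 2 (λ p q → p :- q := :- (q :- p)) refl p q))
                          (ℚ.∣-p∣≡∣p∣ (q - p))

  p≤∣p∣ : ∀ p → p ≤ ∣ p ∣
  p≤∣p∣ p with ℚ.∣p∣≡p∨∣p∣≡-p p
  ... | inj₁ e = ℚ.≤-reflexive (sym e)
  ... | inj₂ e = ℚ.≤-trans
    (subst (_≤ 0ℚ) (solve 1 (λ p → :- (:- p) := p) refl p)
      (ℚ.neg-antimono-≤ (subst (0ℚ ≤_) e (ℚ.0≤∣p∣ p))))
    (ℚ.0≤∣p∣ p)

  ∣p∣≤ : ∀ {p q} → p ≤ q → - p ≤ q → ∣ p ∣ ≤ q
  ∣p∣≤ {p} h k with ℚ.∣p∣≡p∨∣p∣≡-p p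
  ... | inj₁ e = subst (_≤ _) (sym e) h
  ... | inj₂ e = subst (_≤ _) (sym e) k

  ∣p∣≤∣q∣+∣p-q∣ : ∀ p q → ∣ p ∣ ≤ ∣ q ∣ + ∣ p - q ∣
  ∣p∣≤∣q∣+∣p-q∣ p q = subst (λ z → ∣ z ∣ ≤ ∣ q ∣ + ∣ p - q ∣)
    (solve 2 (λ p q → q :+ (p :- q) := p) refl p q)
    (ℚ.∣p+q∣≤∣p∣+∣q∣ q (p - q))

  -≤ : ∀ {p q r} → p ≤ q + r → p - q ≤ r
  -≤ {p} {q} {r} h = subst (p - q ≤_)
    (solve 2 (λ q r → q :+ r :- q := r) refl q r) (ℚ.+-monoˡ-≤ (- q) h)

  ∣∣p∣-∣q∣∣≤∣p-q∣ : ∀ p q → ∣ ∣ p ∣ - ∣ q ∣ ∣ ≤ ∣ p - q ∣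
  ∣∣p∣-∣q∣∣≤∣p-q∣ p q = ∣p∣≤ (-≤ (∣p∣≤∣q∣+∣p-q∣ p q))
    (subst₂ _≤_ (solve 2 (λ a b → b :- a := :- (a :- b)) refl ∣ p ∣ ∣ q ∣) (∣p-q∣≡∣q-p∣ q p)
      (-≤ (∣p∣≤∣q∣+∣p-q∣ q p)))

  half : ∀ ε → ℚ.½ * ε + ℚ.½ * ε ≡ ε
  half = solve 1 (λ ε → con ℚ.½ :* ε :+ con ℚ.½ :* ε := ε) refl

  0<* : ∀ {p q} → 0ℚ < p → 0ℚ < q → 0ℚ < p * q
  0<* {p} {q} 0<p 0<q = subst (_< p * q) (ℚ.*-zeroʳ p)
    (ℚ.*-monoʳ-<-pos p {{ℚ.positive 0<p}} 0<q)

  0<½ε : ∀ {ε} → 0ℚ < ε → 0ℚ < ℚ.½ * ε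
  0<½ε = 0<* (ℚ.positive⁻¹ ℚ.½)

  sum-close : ∀ a b c d {ε} → ∣ a - b ∣ < ℚ.½ * ε → ∣ c - d ∣ < ℚ.½ * ε →
    ∣ (a + c) - (b + d) ∣ < ε
  sum-close a b c d {ε} h k = begin-strict
    ∣ (a + c) - (b + d) ∣       ≡⟨ cong ∣_∣ (solve 4 (λ a b c d →
                                     (a :+ c) :- (b :+ d) := (a :- b) :+ (c :- d)) refl a b c d) ⟩
    ∣ (a - b) + (c - d) ∣       ≤⟨ ℚ.∣p+q∣≤∣p∣+∣q∣ (a - b) (c - d) ⟩
    ∣ a - b ∣ + ∣ c - d ∣       <⟨ ℚ.+-mono-< h k ⟩
    ℚ.½ * ε + ℚ.½ * ε           ≡⟨ half ε ⟩
    ε                           ∎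
    where open ℚ.≤-Reasoning

  scale : ∀ B ε → 0ℚ < B → 0ℚ < ε → ∃[ η ] (0ℚ < η × B * η ≡ ℚ.½ * ε)
  scale B ε 0<B 0<ε = (ℚ.1/ B) * (ℚ.½ * ε) ,
    0<* (ℚ.positive⁻¹ (ℚ.1/ B) {{ℚ.1/pos⇒pos B}}) (0<½ε 0<ε) ,
    trans (sym (ℚ.*-assoc B (ℚ.1/ B) (ℚ.½ * ε)))
      (trans (cong (_* (ℚ.½ * ε)) (ℚ.*-inverseʳ B)) (ℚ.*-identityˡ (ℚ.½ * ε)))
    where instance
      B>0 : ℚ.Positive B
      B>0 = ℚ.positive 0<B
      B≢0 : ℚ.NonZero B
      B≢0 = ℚ.pos⇒nonZero B {{ℚ.positive 0<B}}

  product-small : ∀ p q {B η γ} → 0ℚ < B → B * η ≡ γ →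
    ∣ p ∣ ≤ B → ∣ q ∣ < η → ∣ p * q ∣ < γ
  product-small p q {B} {η} {γ} 0<B e p≤B q<η = begin-strict
    ∣ p * q ∣       ≡⟨ ℚ.∣p*q∣≡∣p∣*∣q∣ p q ⟩
    ∣ p ∣ * ∣ q ∣   ≤⟨ ℚ.*-monoʳ-≤-nonNeg ∣ q ∣ {{ℚ.∣-∣-nonNeg q}} p≤B ⟩
    B * ∣ q ∣       <⟨ ℚ.*-monoʳ-<-pos B {{ℚ.positive 0<B}} q<η ⟩
    B * η           ≡⟨ e ⟩
    γ               ∎
    where open ℚ.≤-Reasoning

  product-close : ∀ a b c d {A B η θ ε} → 0ℚ < A → 0ℚ < B →
    A * η ≡ ℚ.½ * ε → B * θ ≡ ℚ.½ * ε → ∣ a ∣ ≤ A → ∣ d ∣ ≤ B →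
    ∣ c - d ∣ < η → ∣ a - b ∣ < θ → ∣ a * c - b * d ∣ < ε
  product-close a b c d {ε = ε} 0<A 0<B eη eθ ha hd h k = begin-strict
    ∣ a * c - b * d ∣                     ≡⟨ cong ∣_∣ (solve 4 (λ a b c d →
                                               a :* c :- b :* d := a :* (c :- d) :+ d :* (a :- b)) refl a b c d) ⟩
    ∣ a * (c - d) + d * (a - b) ∣         ≤⟨ ℚ.∣p+q∣≤∣p∣+∣q∣ (a * (c - d)) (d * (a - b)) ⟩
    ∣ a * (c - d) ∣ + ∣ d * (a - b) ∣
      <⟨ ℚ.+-mono-< (product-small a (c - d) 0<A eη ha h) (product-small d (a - b) 0<B eθ hd k) ⟩
    ℚ.½ * ε + ℚ.½ * ε                     ≡⟨ half ε ⟩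
    ε                                     ∎
    where open ℚ.≤-Reasoning

  /-anti-≤ : ∀ {m n} .{{_ : NonZero m}} .{{_ : NonZero n}} → m ℕ.≤ n → (+ 1) / n ≤ (+ 1) / m
  /-anti-≤ {suc m} {suc n} m≤n = ℚ.toℚᵘ-cancel-≤
    (ℚᵘ.≤-respˡ-≃ (ℚᵘ.≃-sym (ℚ.toℚᵘ-fromℚᵘ (ℚᵘ.mkℚᵘ (+ 1) n)))
    (ℚᵘ.≤-respʳ-≃ (ℚᵘ.≃-sym (ℚ.toℚᵘ-fromℚᵘ (ℚᵘ.mkℚᵘ (+ 1) m)))
    (ℚᵘ.*≤* (subst₂ ℤ._≤_ (sym (ℤ.*-identityˡ _)) (sym (ℤ.*-identityˡ _)) (ℤ.+≤+ m≤n)))))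

  0≤1/ : ∀ n .{{_ : NonZero n}} → 0ℚ ≤ (+ 1) / n
  0≤1/ (suc n) = ℚ.nonNegative⁻¹ ((+ 1) / suc n) {{ℚ.normalize-nonNeg 1 (suc n)}}

  archimedean : ∀ {ε} → 0ℚ < ε → ∃ λ N → ∀ n → N ℕ.≤ n → (+ 1) / suc n < ε
  archimedean {ε@(mkℚ (+ zero) d c)} (*<* (ℤ.+<+ ()))
  archimedean {ε@(mkℚ (+ suc p) d c)} _ = suc d , λ n d<n → ℚ.toℚᵘ-cancel-<
    (ℚᵘ.<-respˡ-≃ (ℚᵘ.≃-sym (ℚ.toℚᵘ-fromℚᵘ (ℚᵘ.mkℚᵘ (+ 1) n)))
    (ℚᵘ.*<* (subst (ℤ._< + (suc p ℕ.* suc n)) (sym (ℤ.*-identityˡ _))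
      (ℤ.+<+ (ℕ.<-≤-trans (ℕ.s≤s d<n) (ℕ.m≤m+n (suc n) (p ℕ.* suc n)))))))
  archimedean {ε@(mkℚ (ℤ.-[1+ p ]) d c)} (*<* ())

fromℤ : ℤ → ℚ
fromℤ k = k ℚ./ 1

-- Distance to the nearest integer, needed only for rational t.
-- The minimum of ∣ t - n ∣ over the integers n is attained at one of the
-- two integers surrounding t; see ‖‖-attained and ‖‖-minimal.
‖_‖ : ℚ → ℚ
‖ t ‖ = ℚ.∣ t ℚ.- fromℤ (ℚ.floor t) ∣ ℚ.⊓ ℚ.∣ t ℚ.- fromℤ (ℤ.suc (ℚ.floor t)) ∣

‖‖-attained : ∀ t → ∃[ n ] (‖ t ‖ ≡ ℚ.∣ t ℚ.- fromℤ n ∣)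
‖‖-attained t with ℚ.⊓-sel ℚ.∣ t ℚ.- fromℤ (ℚ.floor t) ∣ ℚ.∣ t ℚ.- fromℤ (ℤ.suc (ℚ.floor t)) ∣
... | inj₁ e = ℚ.floor t , e
... | inj₂ e = ℤ.suc (ℚ.floor t) , e

module Floor where
  open import Data.Rational.Base using (_≤_; _-_; -_; ∣_∣)
  open +-*-Solver using (solve; _:-_; :-_; _:=_)

  fromℤ-mono : ∀ {m n} → m ℤ.≤ n → fromℤ m ≤ fromℤ n
  fromℤ-mono {m} {n} m≤n = ℚ.toℚᵘ-cancel-≤
    (ℚᵘ.≤-respˡ-≃ (ℚᵘ.≃-sym (ℚ.toℚᵘ-fromℚᵘ (ℚᵘ.mkℚᵘ m 0)))
    (ℚᵘ.≤-respʳ-≃ (ℚᵘ.≃-sym (ℚ.toℚᵘ-fromℚᵘ (ℚᵘ.mkℚᵘ n 0)))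
    (ℚᵘ.*≤* (subst₂ ℤ._≤_ (sym (ℤ.*-identityʳ m)) (sym (ℤ.*-identityʳ n)) m≤n))))

  floor≤ : ∀ t → fromℤ (ℚ.floor t) ≤ t
  floor≤ t@(mkℚ n d-1 _) = ℚ.toℚᵘ-cancel-≤
    (ℚᵘ.≤-respˡ-≃ (ℚᵘ.≃-sym (ℚ.toℚᵘ-fromℚᵘ (ℚᵘ.mkℚᵘ (ℚ.floor t) 0)))
    (ℚᵘ.*≤* (subst (ℚ.floor t ℤ.* + suc d-1 ℤ.≤_) (sym (ℤ.*-identityʳ n))
      (ℤ.[n/d]*d≤n n (+ suc d-1)))))

  ≤suc-floor : ∀ t → t ≤ fromℤ (ℤ.suc (ℚ.floor t))
  ≤suc-floor t@(mkℚ n d-1 _) = ℚ.toℚᵘ-cancel-≤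
    (ℚᵘ.≤-respʳ-≃ (ℚᵘ.≃-sym (ℚ.toℚᵘ-fromℚᵘ (ℚᵘ.mkℚᵘ (ℤ.suc (ℚ.floor t)) 0)))
    (ℚᵘ.*≤* (subst (ℤ._≤ ℤ.suc (ℚ.floor t) ℤ.* D) (sym (ℤ.*-identityʳ n)) bound)))
    where
    D = + suc d-1
    bound : n ℤ.≤ ℤ.suc (ℚ.floor t) ℤ.* D
    bound = subst₂ ℤ._≤_ (sym (ℤ.a≡a%n+[a/n]*n n D))
      (sym (ℤ.suc-* (n ℤ./ D) D))
      (ℤ.+-monoˡ-≤ ((n ℤ./ D) ℤ.* D) (ℤ.+≤+ (ℕ.<⇒≤ (ℤ.n%d<d n D))))

  dist-mono-below : ∀ {t m n} → m ≤ n → n ≤ t → ∣ t - n ∣ ≤ ∣ t - m ∣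
  dist-mono-below {t} {m} {n} m≤n n≤t = subst (_≤ ∣ t - m ∣)
    (sym (ℚ.0≤p⇒∣p∣≡p (subst (_≤ t - n) (ℚ.+-inverseʳ n) (ℚ.+-monoˡ-≤ (- n) n≤t))))
    (ℚ.≤-trans (ℚ.+-monoʳ-≤ t (ℚ.neg-antimono-≤ m≤n)) (Rat.p≤∣p∣ (t - m)))

  dist-mono-above : ∀ {t m n} → t ≤ m → m ≤ n → ∣ t - m ∣ ≤ ∣ t - n ∣
  dist-mono-above {t} {m} {n} t≤m m≤n = subst₂ _≤_
    (trans (sym (ℚ.0≤p⇒∣p∣≡p (subst (_≤ m - t) (ℚ.+-inverseʳ t) (ℚ.+-monoˡ-≤ (- t) t≤m))))
      (Rat.∣p-q∣≡∣q-p∣ m t))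
    (Rat.∣p-q∣≡∣q-p∣ n t)
    (ℚ.≤-trans (ℚ.+-monoˡ-≤ (- t) m≤n) (Rat.p≤∣p∣ (n - t)))

‖‖-minimal : ∀ t n → ‖ t ‖ ℚ.≤ ℚ.∣ t ℚ.- fromℤ n ∣
‖‖-minimal t n with n ℤ.≤? ℚ.floor t
... | yes n≤f = ℚ.≤-trans
  (ℚ.p⊓q≤p ℚ.∣ t ℚ.- fromℤ (ℚ.floor t) ∣ ℚ.∣ t ℚ.- fromℤ (ℤ.suc (ℚ.floor t)) ∣)
  (Floor.dist-mono-below {t} (Floor.fromℤ-mono n≤f) (Floor.floor≤ t))
... | no n≰f = ℚ.≤-trans
  (ℚ.p⊓q≤q ℚ.∣ t ℚ.- fromℤ (ℚ.floor t) ∣ ℚ.∣ t ℚ.- fromℤ (ℤ.suc (ℚ.floor t)) ∣)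
  (Floor.dist-mono-above {t} (Floor.≤suc-floor t) (Floor.fromℤ-mono (ℤ.i<j⇒suc[i]≤j (ℤ.≰⇒> n≰f))))

-- A Cauchy sequence of rationals with a modulus.  Distinct values may denote the
-- same real; _≤_ and _<_ respect this identification.
record ℝ : Set where
  constructor mkℝ
  field
    seq    : ℕ → ℚ
    cauchy : ∀ ε → 0ℚ ℚ.< ε →
             ∃[ N ] (∀ m n → N ℕ.≤ m → N ℕ.≤ n → ℚ.∣ seq m ℚ.- seq n ∣ ℚ.< ε)

open ℝ public

infix  4 _≤_ _<_
infixl 6 _+_
infixl 7 _*_

_≤_ : ℝ → ℝ → Set
x ≤ y = ∀ ε → 0ℚ ℚ.< ε → ∃[ N ] (∀ n → N ℕ.≤ n → seq x n ℚ.≤ seq y n ℚ.+ ε)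

_<_ : ℝ → ℝ → Set
x < y = ∃[ ε ] (0ℚ ℚ.< ε × ∃[ N ] (∀ n → N ℕ.≤ n → seq x n ℚ.+ ε ℚ.≤ seq y n))

fromℚ : ℚ → ℝ
fromℚ q = mkℝ (λ _ → q) λ ε 0<ε →
  0 , λ _ _ _ _ → subst (ℚ._< ε) (sym (cong ℚ.∣_∣ (ℚ.+-inverseʳ q))) 0<ε

fromℕ : ℕ → ℝ
fromℕ n = fromℚ (+ n ℚ./ 1)

0ℝ ½ : ℝ
0ℝ = fromℚ 0ℚ
½  = fromℚ ℚ.½

∣_∣ : ℝ → ℝ
∣ x ∣ = mkℝ (λ n → ℚ.∣ seq x n ∣) λ ε 0<ε → let (N , h) = cauchy x ε 0<ε in
  N , λ m n N≤m N≤n → ℚ.≤-<-trans (Rat.∣∣p∣-∣q∣∣≤∣p-q∣ (seq x m) (seq x n)) (h m n N≤m N≤n)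

_+_ : ℝ → ℝ → ℝ
x + y = mkℝ (λ n → seq x n ℚ.+ seq y n) λ ε 0<ε →
  let (M , h) = cauchy x (ℚ.½ ℚ.* ε) (Rat.0<½ε 0<ε)
      (N , k) = cauchy y (ℚ.½ ℚ.* ε) (Rat.0<½ε 0<ε)
  in M ℕ.⊔ N , λ m n m≥ n≥ →
    Rat.sum-close (seq x m) (seq x n) (seq y m) (seq y n)
      (h m n (ℕ.m⊔n≤o⇒m≤o M N m≥) (ℕ.m⊔n≤o⇒m≤o M N n≥))
      (k m n (ℕ.m⊔n≤o⇒n≤o M N m≥) (ℕ.m⊔n≤o⇒n≤o M N n≥))

private
  bounded : ∀ x → ∃[ B ] (0ℚ ℚ.< B × ∃[ N ] (∀ n → N ℕ.≤ n → ℚ.∣ seq x n ∣ ℚ.≤ B))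
  bounded x = let (N , h) = cauchy x 1ℚ (ℚ.positive⁻¹ 1ℚ) in
    ℚ.∣ seq x N ∣ ℚ.+ 1ℚ ,
    ℚ.+-mono-≤-< (ℚ.0≤∣p∣ (seq x N)) (ℚ.positive⁻¹ 1ℚ) ,
    N , λ n N≤n → ℚ.≤-trans (Rat.∣p∣≤∣q∣+∣p-q∣ (seq x n) (seq x N))
      (ℚ.+-monoʳ-≤ ℚ.∣ seq x N ∣ (ℚ.<⇒≤ (h n N N≤n ℕ.≤-refl)))

_*_ : ℝ → ℝ → ℝ
x * y = mkℝ (λ n → seq x n ℚ.* seq y n) λ ε 0<ε →
  let (A , 0<A , N₁ , h₁) = bounded x
      (B , 0<B , N₂ , h₂) = bounded y
      (η , 0<η , eη)      = Rat.scale A ε 0<A 0<ε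
      (θ , 0<θ , eθ)      = Rat.scale B ε 0<B 0<ε
      (N₃ , h₃)           = cauchy y η 0<η
      (N₄ , h₄)           = cauchy x θ 0<θ
      split : ∀ {n} → (N₁ ℕ.⊔ N₂) ℕ.⊔ (N₃ ℕ.⊔ N₄) ℕ.≤ n →
              (N₁ ℕ.≤ n × N₂ ℕ.≤ n) × (N₃ ℕ.≤ n × N₄ ℕ.≤ n)
      split h = let h′ = ℕ.m⊔n≤o⇒m≤o (N₁ ℕ.⊔ N₂) (N₃ ℕ.⊔ N₄) h
                    h″ = ℕ.m⊔n≤o⇒n≤o (N₁ ℕ.⊔ N₂) (N₃ ℕ.⊔ N₄) h
                in (ℕ.m⊔n≤o⇒m≤o N₁ N₂ h′ , ℕ.m⊔n≤o⇒n≤o N₁ N₂ h′) ,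
                   (ℕ.m⊔n≤o⇒m≤o N₃ N₄ h″ , ℕ.m⊔n≤o⇒n≤o N₃ N₄ h″)
  in (N₁ ℕ.⊔ N₂) ℕ.⊔ (N₃ ℕ.⊔ N₄) , λ m n m≥ n≥ →
    let ((m₁ , _) , (m₃ , m₄)) = split m≥
        ((_ , n₂) , (n₃ , n₄)) = split n≥
    in Rat.product-close (seq x m) (seq x n) (seq y m) (seq y n)
         0<A 0<B eη eθ (h₁ m m₁) (h₂ n n₂) (h₃ m n m₃ n₃) (h₄ m n m₄ n₄)

Σ< : ℕ → (ℕ → ℚ) → ℚ
Σ< zero    f = 0ℚ
Σ< (suc n) f = Σ< n f ℚ.+ f n

-- The right-endpoint Riemann sum of 1/t on [1 , a] with mesh 1/n:
-- the terms are (1/n) · 1/(1 + i/n) = 1/(n + i) for 1 ≤ i ≤ (a - 1) n.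
riemannSum : (a n : ℕ) → .{{NonZero n}} → ℚ
riemannSum a n@(suc _) = Σ< ((a ℕ.∸ 1) ℕ.* n) (λ i → (+ 1) ℚ./ (n ℕ.+ suc i))

module Riemann where
  open import Data.Rational.Base using (_/_)
  open +-*-Solver using (solve; _:+_; _:*_; _:-_; :-_; _:=_; con)
  open ℚ.≤-Reasoning

  Σ<-++ : ∀ m n f → Σ< (m ℕ.+ n) f ≡ Σ< m f ℚ.+ Σ< n (λ j → f (m ℕ.+ j))
  Σ<-++ m zero f = trans (cong (λ k → Σ< k f) (ℕ.+-identityʳ m)) (sym (ℚ.+-identityʳ (Σ< m f)))
  Σ<-++ m (suc n) f = trans (cong (λ k → Σ< k f) (ℕ.+-suc m n))
    (trans (cong (ℚ._+ f (m ℕ.+ n)) (Σ<-++ m n f))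
      (ℚ.+-assoc (Σ< m f) (Σ< n (λ j → f (m ℕ.+ j))) (f (m ℕ.+ n))))

  times : ℕ → ℚ → ℚ
  times M c = Σ< M (λ _ → c)

  Σ<-mono : ∀ M f g → (∀ j → j ℕ.< M → f j ℚ.≤ g j) → Σ< M f ℚ.≤ Σ< M g
  Σ<-mono zero f g h = ℚ.≤-refl
  Σ<-mono (suc M) f g h = ℚ.+-mono-≤
    (Σ<-mono M f g (λ j j<M → h j (ℕ.m<n⇒m<1+n j<M))) (h M (ℕ.n<1+n M))

  addfrac : ∀ p q d → (p / suc d) ℚ.+ (q / suc d) ≡ (p ℤ.+ q) / suc d
  addfrac p q d = ℚ.toℚᵘ-injective
    (ℚᵘ.≃-trans (ℚ.toℚᵘ-homo-+ (p / suc d) (q / suc d))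
    (ℚᵘ.≃-trans (ℚᵘ.+-cong (ℚ.toℚᵘ-fromℚᵘ (ℚᵘ.mkℚᵘ p d)) (ℚ.toℚᵘ-fromℚᵘ (ℚᵘ.mkℚᵘ q d)))
    (ℚᵘ.≃-trans (ℚᵘ.*≡* (trans (cong (ℤ._* (+ suc d)) (sym (ℤ.*-distribʳ-+ (+ suc d) p q)))
       (ℤ.*-assoc (p ℤ.+ q) (+ suc d) (+ suc d))))
    (ℚᵘ.≃-sym (ℚ.toℚᵘ-fromℚᵘ (ℚᵘ.mkℚᵘ (p ℤ.+ q) d))))))

  times-/ : ∀ M d → times M ((+ 1) / suc d) ≡ (+ M) / suc d
  times-/ zero d = ℚ.toℚᵘ-injective
    (ℚᵘ.≃-trans (ℚᵘ.*≡* refl) (ℚᵘ.≃-sym (ℚ.toℚᵘ-fromℚᵘ (ℚᵘ.mkℚᵘ (+ 0) d))))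
  times-/ (suc M) d = trans (cong (ℚ._+ ((+ 1) / suc d)) (times-/ M d))
    (trans (addfrac (+ M) (+ 1) d) (cong (λ k → (+ k) / suc d) (ℕ.+-comm M 1)))

  times-cancel : ∀ M K → times (suc M) ((+ 1) / (suc K ℕ.* suc M)) ≡ (+ 1) / suc K
  times-cancel M K = trans (times-/ (suc M) (M ℕ.+ K ℕ.* suc M)) (ℚ.toℚᵘ-injective
    (ℚᵘ.≃-trans (ℚ.toℚᵘ-fromℚᵘ (ℚᵘ.mkℚᵘ (+ suc M) (M ℕ.+ K ℕ.* suc M)))
    (ℚᵘ.≃-trans (ℚᵘ.*≡* (cong +_ (trans (ℕ.*-comm (suc M) (suc K)) (sym (ℕ.*-identityˡ _)))))
    (ℚᵘ.≃-sym (ℚ.toℚᵘ-fromℚᵘ (ℚᵘ.mkℚᵘ (+ 1) K))))))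

  S : (N m : ℕ) .{{_ : NonZero N}} → ℚ
  S N@(suc _) m = Σ< m (λ i → (+ 1) / (N ℕ.+ suc i))

  -- Passing from mesh 1/N to mesh 1/(N M) replaces 1/(N+m+1) by a block of M terms.
  module _ (n M′ : ℕ) where
    private
      N = suc n
      M = suc M′

    block : ℕ → ℚ
    block m = Σ< M (λ j → (+ 1) / (N ℕ.* M ℕ.+ suc (m ℕ.* M ℕ.+ j)))

    S-refine : ∀ m → S (N ℕ.* M) (suc m ℕ.* M) ≡ S (N ℕ.* M) (m ℕ.* M) ℚ.+ block m
    S-refine m = trans (cong (λ k → S (N ℕ.* M) k) (ℕ.+-comm M (m ℕ.* M)))
      (Σ<-++ (m ℕ.* M) M (λ i → (+ 1) / (N ℕ.* M ℕ.+ suc i)))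

    index : ∀ m j → N ℕ.* M ℕ.+ suc (m ℕ.* M ℕ.+ j) ≡ (N ℕ.+ m) ℕ.* M ℕ.+ suc j
    index m j = trans (cong (N ℕ.* M ℕ.+_) (sym (ℕ.+-suc (m ℕ.* M) j)))
      (trans (sym (ℕ.+-assoc (N ℕ.* M) (m ℕ.* M) (suc j)))
        (cong (ℕ._+ suc j) (sym (ℕ.*-distribʳ-+ M N m))))

    block-lower : ∀ m → (+ 1) / suc (N ℕ.+ m) ℚ.≤ block m
    block-lower m = subst (ℚ._≤ block m) (times-cancel M′ (N ℕ.+ m))
      (Σ<-mono M (λ _ → (+ 1) / (suc (N ℕ.+ m) ℕ.* M)) (λ j → (+ 1) / (N ℕ.* M ℕ.+ suc (m ℕ.* M ℕ.+ j)))
        λ j j<M → Rat./-anti-≤ (subst (ℕ._≤ suc (N ℕ.+ m) ℕ.* M) (sym (index m j))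
          (ℕ.≤-trans (ℕ.+-monoʳ-≤ ((N ℕ.+ m) ℕ.* M) j<M)
            (ℕ.≤-reflexive (ℕ.+-comm ((N ℕ.+ m) ℕ.* M) M)))))

    block-upper : ∀ m → block m ℚ.≤ (+ 1) / (N ℕ.+ m)
    block-upper m = subst (block m ℚ.≤_) (times-cancel M′ (n ℕ.+ m))
      (Σ<-mono M (λ j → (+ 1) / (N ℕ.* M ℕ.+ suc (m ℕ.* M ℕ.+ j))) (λ _ → (+ 1) / ((N ℕ.+ m) ℕ.* M))
        λ j _ → Rat./-anti-≤ (subst ((N ℕ.+ m) ℕ.* M ℕ.≤_) (sym (index m j))
          (ℕ.m≤m+n ((N ℕ.+ m) ℕ.* M) (suc j))))

    lower : ∀ m → S N m ℚ.≤ S (N ℕ.* M) (m ℕ.* M)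
    lower zero = ℚ.≤-refl
    lower (suc m) = begin
      S N m ℚ.+ (+ 1) / (N ℕ.+ suc m)           ≡⟨ cong (λ k → S N m ℚ.+ (+ 1) / suc k) (ℕ.+-suc n m) ⟩
      S N m ℚ.+ (+ 1) / suc (N ℕ.+ m)           ≤⟨ ℚ.+-mono-≤ (lower m) (block-lower m) ⟩
      S (N ℕ.* M) (m ℕ.* M) ℚ.+ block m         ≡⟨ S-refine m ⟨
      S (N ℕ.* M) (suc m ℕ.* M)                 ∎

    upper′ : ∀ m → S (N ℕ.* M) (m ℕ.* M) ℚ.+ (+ 1) / (N ℕ.+ m) ℚ.≤ S N m ℚ.+ (+ 1) / N
    upper′ zero = ℚ.≤-reflexive (cong (λ k → 0ℚ ℚ.+ (+ 1) / suc k) (ℕ.+-identityʳ n))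
    upper′ (suc m) = begin
      S (N ℕ.* M) (suc m ℕ.* M) ℚ.+ t             ≡⟨ cong (ℚ._+ t) (S-refine m) ⟩
      (S (N ℕ.* M) (m ℕ.* M) ℚ.+ block m) ℚ.+ t
        ≤⟨ ℚ.+-monoˡ-≤ t (ℚ.+-monoʳ-≤ (S (N ℕ.* M) (m ℕ.* M)) (block-upper m)) ⟩
      (S (N ℕ.* M) (m ℕ.* M) ℚ.+ (+ 1) / (N ℕ.+ m)) ℚ.+ t
        ≤⟨ ℚ.+-monoˡ-≤ t (upper′ m) ⟩
      (S N m ℚ.+ (+ 1) / N) ℚ.+ t
        ≡⟨ solve 3 (λ a b c → (a :+ b) :+ c := (a :+ c) :+ b) refl (S N m) ((+ 1) / N) t ⟩
      (S N m ℚ.+ t) ℚ.+ (+ 1) / N                 ∎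
      where t = (+ 1) / (N ℕ.+ suc m)

    upper : ∀ m → S (N ℕ.* M) (m ℕ.* M) ℚ.≤ S N m ℚ.+ (+ 1) / N
    upper m = ℚ.≤-trans
      (subst (ℚ._≤ S (N ℕ.* M) (m ℕ.* M) ℚ.+ (+ 1) / (N ℕ.+ m)) (ℚ.+-identityʳ _)
        (ℚ.+-monoʳ-≤ (S (N ℕ.* M) (m ℕ.* M)) (Rat.0≤1/ (N ℕ.+ m))))
      (upper′ m)

  -- Compare both sums with the one on the common refinement.
  compare : ∀ a m n → riemannSum a (suc m) ℚ.≤ riemannSum a (suc n) ℚ.+ (+ 1) / suc n
  compare a m n = begin
    S M (b ℕ.* M)                         ≤⟨ lower m n (b ℕ.* M) ⟩
    S (M ℕ.* N) (b ℕ.* M ℕ.* N)           ≡⟨ flip ⟩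
    S (N ℕ.* M) (b ℕ.* N ℕ.* M)           ≤⟨ upper n m (b ℕ.* N) ⟩
    S N (b ℕ.* N) ℚ.+ (+ 1) / N           ∎
    where
    b = a ℕ.∸ 1
    M = suc m
    N = suc n
    S-cong : ∀ {p q k l} → suc p ≡ suc q → k ≡ l → S (suc p) k ≡ S (suc q) l
    S-cong refl refl = refl
    flip : S (M ℕ.* N) (b ℕ.* M ℕ.* N) ≡ S (N ℕ.* M) (b ℕ.* N ℕ.* M)
    flip = S-cong (ℕ.*-comm M N)
      (trans (ℕ.*-assoc b M N) (trans (cong (b ℕ.*_) (ℕ.*-comm M N)) (sym (ℕ.*-assoc b N M))))

  cauchy-log : ∀ a ε → 0ℚ ℚ.< ε → ∃[ N ] (∀ m n → N ℕ.≤ m → N ℕ.≤ n →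
    ℚ.∣ riemannSum a (suc m) ℚ.- riemannSum a (suc n) ∣ ℚ.< ε)
  cauchy-log a ε 0<ε = let (N , h) = Rat.archimedean 0<ε in
    N , λ m n N≤m N≤n → close m n (h m N≤m) (h n N≤n)
    where
    close : ∀ m n → (+ 1) / suc m ℚ.< ε → (+ 1) / suc n ℚ.< ε →
      ℚ.∣ riemannSum a (suc m) ℚ.- riemannSum a (suc n) ∣ ℚ.< ε
    close m n hm hn with ℚ.∣p∣≡p∨∣p∣≡-p (riemannSum a (suc m) ℚ.- riemannSum a (suc n))
    ... | inj₁ e = subst (ℚ._< ε) (sym e) (ℚ.≤-<-trans (Rat.-≤ (compare a m n)) hn)
    ... | inj₂ e = subst (ℚ._< ε)
      (sym (trans e (solve 2 (λ p q → :- (p :- q) := q :- p) refl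
        (riemannSum a (suc m)) (riemannSum a (suc n)))))
      (ℚ.≤-<-trans (Rat.-≤ (compare a n m)) hm)

-- log a = ∫₁ᵃ dt/t
log : (a : ℕ) → .{{NonZero a}} → ℝ
log a = mkℝ (λ n → riemannSum a (suc n)) (Riemann.cauchy-log a)

HasCardinality : (ℕ → Set) → ℕ → Set
HasCardinality P N =
  ∃[ xs ] (Unique xs × (∀ x → x ∈ xs ⇔ P x) × length xs ≡ N)

Counted : (a : ℕ) .{{_ : NonZero a}} → ℝ → ℕ → Set
Counted a δ x = 1 ℕ.≤ x × x ℕ.≤ a × fromℚ ‖ + (x ℕ.* x) ℚ./ a ‖ ≤ δ

-- A(a , δ) is given by its graph, since membership in the set it counts is
-- undecidable for a general real δ.  By A-exists a value cannot fail to exist.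
A[_,_]≡_ : (a : ℕ) .{{_ : NonZero a}} → ℝ → ℕ → Set
A[ a , δ ]≡ N = HasCardinality (Counted a δ) N

private
  Among : List ℕ → (ℕ → Set) → List ℕ → Set
  Among ys P xs = Unique xs × (∀ x → x ∈ xs ⇔ (x ∈ ys × P x))

  select : ∀ P ys → Unique ys → ¬ ¬ (∃[ xs ] Among ys P xs)
  select P [] _ k = k ([] , [] , λ x → mk⇔ (λ ()) (λ { (() , _) }))
  select P (y ∷ ys) (y∉ ∷ uniq) k = select P ys uniq λ { (xs , u , h) →
    let without : ¬ P y → ∃[ zs ] Among (y ∷ ys) P zs
        without ¬py = xs , u , λ x → mk⇔
          (λ x∈ → let (m , p) = Equivalence.to (h x) x∈ in there m , p)
          (λ { (here refl , p) → ⊥-elim (¬py p)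
             ; (there m , p) → Equivalence.from (h x) (m , p) })
        with′ : P y → ∃[ zs ] Among (y ∷ ys) P zs
        with′ py = y ∷ xs ,
          All.tabulate (λ x∈ → All.lookup y∉ (proj₁ (Equivalence.to (h _) x∈))) ∷ u ,
          λ x → mk⇔
            (λ { (here refl) → here refl , py
               ; (there x∈) → let (m , p) = Equivalence.to (h x) x∈ in there m , p })
            (λ { (here e , _) → here e
               ; (there m , p) → there (Equivalence.from (h x) (m , p)) })
    in k (without (λ py → k (with′ py))) }

A-exists : ∀ a .{{_ : NonZero a}} δ → ¬ ¬ (∃[ N ] (A[ a , δ ]≡ N))
A-exists a δ k =
  select (Counted a δ) (applyUpTo suc a)
    (applyUpTo⁺₁ suc a λ i<j _ e → ℕ.<-irrefl (ℕ.suc-injective e) i<j)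
    λ { (xs , u , h) → k (length xs , xs , u ,
      (λ x → mk⇔ (λ x∈ → proj₂ (Equivalence.to (h x) x∈))
                 (λ c → Equivalence.from (h x) (range x c , c))) , refl) }
  where
  range : ∀ x → Counted a δ x → x ∈ applyUpTo suc a
  range (suc x) (_ , x≤a , _) = ∈-applyUpTo⁺ suc x≤a

divisors : ℕ → List ℕ
divisors n = filter (_∣? n) (applyUpTo suc n)

d : ℕ → ℕ
d n = length (divisors n)

σ : ℕ → ℕ
σ n = sum (divisors n)

IsSquarePart : ℕ → ℕ → Set
IsSquarePart r a = (r ℕ.* r) divides a × (∀ s → (s ℕ.* s) divides a → s ℕ.≤ r)

module Submission where

-- Write x² ≡ κ (mod a) with |κ| = a ‖x²/a‖, and let K be the largest |κ| that occurs, so K ≤ δ a.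
-- The x with κ = 0 are the multiples of a/r, at most r ≤ σ(r) of them.  For κ ≠ 0 fix one
-- root x₀: any other root x gives a divisor g = gcd(x - x₀, a) of a with a/g ∣ x + x₀, and with
-- t = gcd(g, a/g) each g accounts for at most t roots, and for none unless t² ∣ 4κ.  Since
-- t · #{k ≤ K : t² ∣ 4k} ≤ 4K, summing over g and κ gives A(a, δ) ≤ σ(r) + 8 δ a d(a).
-- The logarithm is only needed to be at least ½ for a ≥ 2; for a = 1 there is one x.

open import Defs
open import Data.Bool.Base using (if_then_else_)
open import Data.Integer.Base as ℤ using (ℤ; +_; -[1+_]; +[1+_])
open import Data.Integer.Divisibility.Signed as ℤ∣ using () renaming (_∣_ to _∣ᶻ_)
import Data.Integer.Properties as ℤ
import Data.Integer.Tactic.RingSolver as ℤR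
open import Data.List.Base using (List; []; _∷_; _++_; length; map; filter; upTo; applyUpTo)
open import Data.List.Membership.Propositional using (_∈_; lose)
open import Data.List.Membership.Propositional.Properties
  using (∈-filter⁺; ∈-filter⁻; ∈-applyUpTo⁺; ∈-upTo⁺; ∈-map⁺; ∈-++⁺ˡ; ∈-++⁺ʳ; ∈-length)
import Data.List.Properties as List
open import Data.List.Relation.Unary.All as All using (All; []; _∷_)
import Data.List.Relation.Unary.All.Properties as All
open import Data.List.Relation.Unary.AllPairs using ([]; _∷_)
open import Data.List.Relation.Unary.Any using (Any; here; there)
open import Data.List.Relation.Unary.Unique.Propositional using (Unique)
import Data.List.Relation.Unary.Unique.Propositional.Properties as Unique
open import Data.Nat.Base as ℕ using (ℕ; zero; suc; NonZero; z≤n; s≤s)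
open import Data.Nat.Coprimality using (Coprime; coprime-divisor)
open import Data.Nat.Divisibility as ℕ∣ using (_∣?_; divides) renaming (_∣_ to _∣ⁿ_)
open import Data.Nat.DivMod using (_%_; m≡m%n+[m/n]*n; m%n<n; m<n*o⇒m/o<n; m/n*n≡m; m/n*n≤m; /-monoˡ-≤)
open import Data.Nat.GCD using (gcd; gcd[m,n]∣m; gcd[m,n]∣n; gcd-greatest; c*gcd[m,n]≡gcd[cm,cn]; gcd[m,n]≡0⇒m≡0)
open import Data.Nat.LCM using (lcm; lcm-least; gcd*lcm)
open import Data.Nat.ListAction using (sum)
open import Data.Nat.ListAction.Properties using (sum-++)
import Data.Nat.Properties as ℕ
import Data.Nat.Tactic.RingSolver as ℕR
open import Data.Product using (Σ-syntax; ∃-syntax; _×_; _,_; proj₁; proj₂)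
open import Data.Rational.Base as ℚ using (ℚ; 0ℚ)
import Data.Rational.Properties as ℚ
open import Data.Rational.Solver using (module +-*-Solver)
import Data.Rational.Unnormalised.Base as ℚᵘ
import Data.Rational.Unnormalised.Properties as ℚᵘ
open import Data.Sum.Base using (_⊎_; inj₁; inj₂)
open import Function.Base using (_∘_)
open import Function.Bundles using (Equivalence)
open import Relation.Binary.PropositionalEquality
open import Relation.Nullary using (¬_; Dec; yes; no; does; ¬?; contradiction; _×-dec_)

-- Counting by fibres

module _ {A : Set} where

  length-filter-complement : ∀ {P : A → Set} (P? : ∀ x → Dec (P x)) xs →
    length xs ≡ length (filter P? xs) ℕ.+ length (filter (¬? ∘ P?) xs)
  length-filter-complement P? [] = refl
  length-filter-complement P? (x ∷ xs) with P? x
  ... | yes _ = cong suc (length-filter-complement P? xs)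
  ... | no _  = trans (cong suc (length-filter-complement P? xs)) (sym (ℕ.+-suc _ _))

  length≤1 : ∀ {xs : List A} → Unique xs → (∀ {x y} → x ∈ xs → y ∈ xs → x ≡ y) → length xs ℕ.≤ 1
  length≤1 {[]}        _                 _  = z≤n
  length≤1 {_ ∷ []}    _                 _  = s≤s z≤n
  length≤1 {_ ∷ _ ∷ _} ((x≢y ∷ _) ∷ _) eq = contradiction (eq (here refl) (there (here refl))) x≢y

  module _ {B : Set} {P : A → Set} {R : A → B → Set} (R? : ∀ x y → Dec (R x y)) (b : B → ℕ) where

    -- Induction on `ys`: each `x` is charged to the first `y` related to it and then removed, so
    -- the fibres may overlap. The predicate `P` carries what is known about every `x` into the
    -- fibre bounds.
    length≤sum-fibres : ∀ ys →
      (∀ {y} → y ∈ ys → ∀ {zs} → Unique zs → All (λ z → P z × R z y) zs → length zs ℕ.≤ b y) →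
      ∀ {xs} → Unique xs → All (λ x → P x × Any (R x) ys) xs → length xs ℕ.≤ sum (map b ys)
    length≤sum-fibres []       fibre {[]}     _ _              = z≤n
    length≤sum-fibres []       fibre {_ ∷ _}  _ ((_ , ()) ∷ _)
    length≤sum-fibres (y ∷ ys) fibre {xs} uniq cov =
      subst (ℕ._≤ _) (sym (length-filter-complement R?y xs)) (ℕ.+-mono-≤
        (fibre (here refl) (Unique.filter⁺ R?y uniq)
          (All.zip (All.map proj₁ (All.filter⁺ R?y cov) , All.all-filter R?y xs)))
        (length≤sum-fibres ys (fibre ∘ there) (Unique.filter⁺ (¬? ∘ R?y) uniq)
          (All.map skip (All.zip (All.filter⁺ (¬? ∘ R?y) cov , All.all-filter (¬? ∘ R?y) xs)))))
      where
      R?y = λ x → R? x y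
      skip : ∀ {x} → (P x × Any (R x) (y ∷ ys)) × ¬ R x y → P x × Any (R x) ys
      skip ((p , here r)  , ¬r) = contradiction r ¬r
      skip ((p , there m) , ¬r) = p , m

sum-map-+ : ∀ {A : Set} (f g : A → ℕ) xs →
  sum (map (λ x → f x ℕ.+ g x) xs) ≡ sum (map f xs) ℕ.+ sum (map g xs)
sum-map-+ f g []       = refl
sum-map-+ f g (x ∷ xs) = trans (cong (f x ℕ.+ g x ℕ.+_) (sum-map-+ f g xs))
  (interchange (f x) (g x) _ _)
  where
  interchange : ∀ a b c d → a ℕ.+ b ℕ.+ (c ℕ.+ d) ≡ a ℕ.+ c ℕ.+ (b ℕ.+ d)
  interchange = ℕR.solve-∀

sum-swap : ∀ {A B : Set} (f : A → B → ℕ) xs ys →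
  sum (map (λ x → sum (map (f x) ys)) xs) ≡ sum (map (λ y → sum (map (λ x → f x y) xs)) ys)
sum-swap f []       ys = sym (sum-zero ys)
  where
  sum-zero : ∀ ys → sum (map (λ _ → 0) ys) ≡ 0
  sum-zero []       = refl
  sum-zero (_ ∷ ys) = sum-zero ys
sum-swap f (x ∷ xs) ys = trans (cong (sum (map (f x) ys) ℕ.+_) (sum-swap f xs ys))
  (sym (sum-map-+ (f x) (λ y → sum (map (λ x → f x y) xs)) ys))

sum-map≤ : ∀ {A : Set} (f : A → ℕ) c ys → (∀ y → f y ℕ.≤ c) → sum (map f ys) ℕ.≤ length ys ℕ.* c
sum-map≤ f c []       h = z≤n
sum-map≤ f c (y ∷ ys) h = ℕ.+-mono-≤ (h y) (sum-map≤ f c ys h)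

∈⇒≤sum : ∀ {x xs} → x ∈ xs → x ℕ.≤ sum xs
∈⇒≤sum (here refl)         = ℕ.m≤m+n _ _
∈⇒≤sum {xs = y ∷ _} (there x∈) = ℕ.≤-trans (∈⇒≤sum x∈) (ℕ.m≤n+m _ y)

-- Congruences

-- The difference has absolute value at most max(m, n) < L, whereas a nonzero multiple of L has
-- absolute value at least L.
congruent⇒≡ : ∀ {L m n} → m ℕ.< L → n ℕ.< L → + L ∣ᶻ + m ℤ.- + n → m ≡ n
congruent⇒≡ {L} {m} {n} m<L n<L L∣ with ℤ.∣ + m ℤ.- + n ∣ in eq | ℤ∣.∣⇒∣ᵤ L∣
... | zero  | _ = ℤ.+-injective (ℤ.i-j≡0⇒i≡j (+ m) (+ n) (ℤ.∣i∣≡0⇒i≡0 eq))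
... | suc k | L∣k = contradiction (ℕ∣.∣⇒≤ L∣k) (ℕ.<⇒≱ (subst (ℕ._< L) eq (ℕ.≤-<-trans
  (subst (λ i → ℤ.∣ i ∣ ℕ.≤ m ℕ.⊔ n) (sym (ℤ.m-n≡m⊖n m n)) (ℤ.∣m⊝n∣≤m⊔n m n))
  (ℕ.⊔-lub m<L n<L))))

InRange : ℕ → ℕ → Set
InRange a z = 1 ℕ.≤ z × z ℕ.≤ a

-- The interval [1, tL] splits into t blocks of L consecutive integers. Two congruent members of one
-- block have equal remainders, so each block holds at most one member.
congruent-count : ∀ t L {zs} → Unique zs → All (InRange (t ℕ.* L)) zs →
  (∀ {x y} → x ∈ zs → y ∈ zs → + L ∣ᶻ + x ℤ.- + y) → length zs ℕ.≤ t
congruent-count t zero {[]} _ _ _ = z≤n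
congruent-count t zero {z ∷ _} _ ((1≤z , z≤) ∷ _) _ =
  contradiction (ℕ.≤-trans 1≤z (subst (z ℕ.≤_) (ℕ.*-zeroʳ t) z≤)) λ ()
congruent-count t L@(suc _) {zs} uniq range cong-zs =
  subst (length zs ℕ.≤_) (ones (upTo t) (List.length-upTo t))
    -- The block of z is the quotient of z - 1, not of z: the blocks then start at 1, and z = tL
    -- falls into the last one.
    (length≤sum-fibres {P = λ z → z ∈ zs × 1 ℕ.≤ z} (λ z q → ((z ℕ.∸ 1) ℕ./ L) ℕ.≟ q) (λ _ → 1) (upTo t)
      (λ _ u all → length≤1 u λ x∈ y∈ → same (All.lookup all x∈) (All.lookup all y∈))
      uniq (All.tabulate λ {z} z∈ →
        (z∈ , proj₁ (All.lookup range z∈)) , lose (∈-upTo⁺ (quotient< (All.lookup range z∈))) refl))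
  where
  ones : ∀ {n} (ys : List ℕ) → length ys ≡ n → sum (map (λ _ → 1) ys) ≡ n
  ones []       refl = refl
  ones (_ ∷ ys) refl = cong suc (ones ys refl)

  quotient< : ∀ {z} → InRange (t ℕ.* L) z → (z ℕ.∸ 1) ℕ./ L ℕ.< t
  quotient< {suc z} (_ , z≤) = m<n*o⇒m/o<n z≤

  shift : ∀ r s q l → (+ 1 ℤ.+ (r ℤ.+ q ℤ.* l)) ℤ.- (+ 1 ℤ.+ (s ℤ.+ q ℤ.* l)) ≡ r ℤ.- s
  shift = ℤR.solve-∀

  euclid : ∀ x → + suc x ≡ + 1 ℤ.+ (+ (x % L) ℤ.+ + (x ℕ./ L) ℤ.* + L)
  euclid x = cong (ℤ._+_ (+ 1)) (trans (cong +_ (m≡m%n+[m/n]*n x L))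
    (cong (ℤ._+_ (+ (x % L))) (ℤ.pos-* (x ℕ./ L) L)))

  same : ∀ {x y q} → (x ∈ zs × 1 ℕ.≤ x) × (x ℕ.∸ 1) ℕ./ L ≡ q →
    (y ∈ zs × 1 ℕ.≤ y) × (y ℕ.∸ 1) ℕ./ L ≡ q → x ≡ y
  same {suc x} {suc y} {q} ((x∈ , _) , refl) ((y∈ , _) , eq) = cong suc (begin
    x                            ≡⟨ m≡m%n+[m/n]*n x L ⟩
    x % L ℕ.+ (x ℕ./ L) ℕ.* L    ≡⟨ cong₂ (λ r s → r ℕ.+ s ℕ.* L) r≡ (sym eq) ⟩
    y % L ℕ.+ (y ℕ./ L) ℕ.* L    ≡⟨ m≡m%n+[m/n]*n y L ⟨
    y                            ∎)
    where
    open ≡-Reasoning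
    r≡ : x % L ≡ y % L
    r≡ = congruent⇒≡ (m%n<n x L) (m%n<n y L) (subst (+ L ∣ᶻ_)
      (trans (cong₂ ℤ._-_ (euclid x)
               (trans (euclid y) (cong (λ k → + 1 ℤ.+ (+ (y % L) ℤ.+ + k ℤ.* + L)) eq)))
             (shift (+ (x % L)) (+ (y % L)) (+ q) (+ L)))
      (cong-zs x∈ y∈))

-- Square roots modulo a

-- Both m w and a w are multiples of a, hence so is their gcd, which is w gcd(m, a).
∣*⇒∣gcd* : ∀ {a} m w → a ∣ⁿ m ℕ.* w → a ∣ⁿ gcd m a ℕ.* w
∣*⇒∣gcd* {a} m w a∣ = subst (a ∣ⁿ_)
  (trans (sym (c*gcd[m,n]≡gcd[cm,cn] w m a)) (ℕ.*-comm w (gcd m a)))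
  (gcd-greatest (subst (a ∣ⁿ_) (ℕ.*-comm m w) a∣) (ℕ∣.n∣m*n w))

square-* : ∀ x y → (x ℕ.* y) ℕ.* (x ℕ.* y) ≡ (x ℕ.* x) ℕ.* (y ℕ.* y)
square-* = ℕR.solve-∀

-- Dividing by the gcd leaves coprime m′ and n′ with m′² dividing n′². Coprimality gives m′ ∣ n′, so
-- m′ = 1 and m is the gcd itself.
square-∣⇒∣ : ∀ m n .{{_ : NonZero m}} → m ℕ.* m ∣ⁿ n ℕ.* n → m ∣ⁿ n
square-∣⇒∣ m n mm∣nn with gcd m n in eq | gcd[m,n]∣m m n | gcd[m,n]∣n m n
... | zero    | _ | _ = contradiction (gcd[m,n]≡0⇒m≡0 eq) (ℕ.≢-nonZero⁻¹ m)
... | g@(suc _) | divides m′ m≡ | divides n′ n≡ =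
  subst (_∣ⁿ n) (sym (trans m≡ (trans (cong (ℕ._* g) m′≡1) (ℕ.*-identityˡ g)))) (divides n′ n≡)
  where
  coprime : Coprime m′ n′
  coprime {k} (k∣m′ , k∣n′) = ℕ∣.∣1⇒≡1 (ℕ∣.*-cancelʳ-∣ g
    (subst (k ℕ.* g ∣ⁿ_) (trans eq (sym (ℕ.*-identityˡ g)))
      (gcd-greatest (subst (k ℕ.* g ∣ⁿ_) (sym m≡) (ℕ∣.*-monoˡ-∣ g k∣m′))
                    (subst (k ℕ.* g ∣ⁿ_) (sym n≡) (ℕ∣.*-monoˡ-∣ g k∣n′)))))
  m′m′∣n′n′ : m′ ℕ.* m′ ∣ⁿ n′ ℕ.* n′
  m′m′∣n′n′ = ℕ∣.*-cancelʳ-∣ (g ℕ.* g) (subst₂ _∣ⁿ_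
    (trans (cong (λ k → k ℕ.* k) m≡) (square-* m′ g))
    (trans (cong (λ k → k ℕ.* k) n≡) (square-* n′ g)) mm∣nn)
  m′≡1 : m′ ≡ 1
  m′≡1 = coprime (ℕ∣.∣-refl , coprime-divisor coprime (ℕ∣.m*n∣⇒m∣ m′ m′ m′m′∣n′n′))

SquareFree : ℕ → Set
SquareFree m = ∀ s → s ℕ.* s ∣ⁿ m → s ℕ.≤ 1

-- With g = gcd(y, m), replacing the factors of y² by g one at a time gives m ∣ g². Writing m = q g,
-- this says q ∣ g, so q² ∣ m and squarefreeness forces q = 1.
squareFree-∣square⇒∣ : ∀ {m} y .{{_ : NonZero m}} → SquareFree m → m ∣ⁿ y ℕ.* y → m ∣ⁿ y
squareFree-∣square⇒∣ {m} y sf m∣yy with gcd y m in eq | gcd[m,n]∣m y m | gcd[m,n]∣n y m | twice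
  where
  twice : m ∣ⁿ gcd y m ℕ.* gcd y m
  twice = ∣*⇒∣gcd* y (gcd y m) (subst (m ∣ⁿ_) (ℕ.*-comm (gcd y m) y) (∣*⇒∣gcd* y y m∣yy))
... | zero      | _   | 0∣m          | _    = contradiction (ℕ∣.0∣⇒≡0 0∣m) (ℕ.≢-nonZero⁻¹ m)
... | g@(suc _) | g∣y | divides q m≡ | m∣gg = finish q m≡
  (sf q (subst (q ℕ.* q ∣ⁿ_) (sym m≡)
    (ℕ∣.*-monoʳ-∣ q (ℕ∣.*-cancelʳ-∣ g (subst (_∣ⁿ g ℕ.* g) m≡ m∣gg)))))
  where
  finish : ∀ q → m ≡ q ℕ.* g → q ℕ.≤ 1 → m ∣ⁿ y
  finish zero          m≡0 _        = contradiction m≡0 (ℕ.≢-nonZero⁻¹ m)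
  finish (suc zero)    m≡  _        = subst (_∣ⁿ y) (sym (trans m≡ (ℕ.*-identityˡ g))) g∣y
  finish (suc (suc _)) _   (s≤s ())

squarePart>0 : ∀ {r a} → IsSquarePart r a → 1 ℕ.≤ r
squarePart>0 (_ , max) = max 1 (ℕ∣.1∣ _)

-- Maximality of r makes m = a/r² squarefree, so the roots are the multiples of m r.
count-square≡0 : ∀ a .{{_ : NonZero a}} {r} → IsSquarePart r a → ∀ {zs} → Unique zs →
  All (λ z → InRange a z × a ∣ⁿ z ℕ.* z) zs → length zs ℕ.≤ r
count-square≡0 a {r} sp@(divides m a≡ , max) uniq roots =
  congruent-count r (m ℕ.* r) uniq
    (All.map (λ { ((1≤z , z≤a) , _) → 1≤z , subst (_ ℕ.≤_) (trans a≡ (rotate m r)) z≤a }) roots)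
    λ x∈ y∈ → ℤ∣.∣m∣n⇒∣m-n (multiple x∈) (multiple y∈)
  where
  rotate : ∀ m r → m ℕ.* (r ℕ.* r) ≡ r ℕ.* (m ℕ.* r)
  rotate = ℕR.solve-∀
  instance
    r≢0 : NonZero r
    r≢0 = ℕ.>-nonZero (squarePart>0 sp)
    rr≢0 : NonZero (r ℕ.* r)
    rr≢0 = ℕ.m*n≢0 r r
    m≢0 : NonZero m
    m≢0 = ℕ.≢-nonZero λ m≡0 → ℕ.≢-nonZero⁻¹ a (trans a≡ (cong (ℕ._* (r ℕ.* r)) m≡0))
  squareFree : SquareFree m
  -- If s² ∣ m then (s r)² ∣ a, so maximality of r gives s r ≤ r.
  squareFree s ss∣m = ℕ.*-cancelʳ-≤ s 1 r (subst (s ℕ.* r ℕ.≤_) (sym (ℕ.*-identityˡ r))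
    (max (s ℕ.* r) (subst₂ _∣ⁿ_ (sym (square-* s r)) (sym a≡) (ℕ∣.*-monoˡ-∣ (r ℕ.* r) ss∣m))))
  root⇒multiple : ∀ z → a ∣ⁿ z ℕ.* z → m ℕ.* r ∣ⁿ z
  root⇒multiple z a∣zz with square-∣⇒∣ r z (ℕ∣.∣-trans (divides m a≡) a∣zz)
  -- With z = y r and a = m r², the factor r² cancels from a ∣ z², leaving m ∣ y².
  ... | divides y refl = ℕ∣.*-monoˡ-∣ r (squareFree-∣square⇒∣ y squareFree
    (ℕ∣.*-cancelʳ-∣ (r ℕ.* r) (subst₂ _∣ⁿ_ a≡ (square-* y r) a∣zz)))
  multiple : ∀ {z} → z ∈ _ → + (m ℕ.* r) ∣ᶻ + z
  multiple z∈ = ℤ∣.∣ᵤ⇒∣ (root⇒multiple _ (proj₂ (All.lookup roots z∈)))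

-- Roots of a nonzero residue, sorted by divisors of `a`

∈-divisors : ∀ {a g} .{{_ : NonZero a}} → g ∣ⁿ a → g ∈ divisors a
∈-divisors {a} {zero}  0∣a = contradiction (ℕ∣.0∣⇒≡0 0∣a) (ℕ.≢-nonZero⁻¹ a)
∈-divisors {a} {suc g} g∣a = ∈-filter⁺ (_∣? a) (∈-applyUpTo⁺ suc (ℕ∣.∣⇒≤ g∣a)) g∣a

-- gcd(g, a/g); the value at g = 0 is junk.
common : ℕ → ℕ → ℕ
common a zero      = 1
common a g@(suc _) = gcd g (a ℕ./ g)

common≢0 : ∀ a g → NonZero (common a g)
common≢0 a zero      = _
common≢0 a g@(suc _) = ℕ.≢-nonZero λ eq → contradiction (gcd[m,n]≡0⇒m≡0 {g} {a ℕ./ g} eq) λ ()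

-- Bounds the number of roots of a residue ±k attached to a divisor g with `common a g` equal to t:
-- at most t, and none unless t² ∣ 4k.
hit : ℕ → ℕ → ℕ
hit t k = if does (t ℕ.* t ∣? 4 ℕ.* k) then t else 0

hit-∣ : ∀ t k → t ℕ.* t ∣ⁿ 4 ℕ.* k → hit t k ≡ t
hit-∣ t k tt∣4k with t ℕ.* t ∣? 4 ℕ.* k
... | yes _ = refl
... | no ∤  = contradiction tt∣4k ∤

-- If t divides both a divisor g of a and a/g, then z ≡ x₀ (mod g) and z ≡ -x₀ (mod a/g)
-- give t ∣ 2 x₀, hence t² ∣ 4 x₀² ≡ 4 κ.  The two congruences determine z
-- modulo lcm(g, a/g) = a/t.
count-factored-roots : ∀ a .{{_ : NonZero a}} κ x₀ g → g ∣ⁿ a → + a ∣ᶻ x₀ ℤ.* x₀ ℤ.- κ →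
  ∀ {zs} → Unique zs →
  All (λ z → InRange a z × + g ∣ᶻ + z ℤ.- x₀ × + a ∣ᶻ + g ℤ.* (+ z ℤ.+ x₀)) zs →
  length zs ℕ.≤ hit (common a g) ℤ.∣ κ ∣
count-factored-roots a κ x₀ zero    0∣a _ _ _ = contradiction (ℕ∣.0∣⇒≡0 0∣a) (ℕ.≢-nonZero⁻¹ a)
-- The empty list satisfies any bound. A nonempty one supplies a root z, from which t² ∣ 4κ follows,
-- so that `hit` takes the value t.
count-factored-roots a κ x₀ (suc _) _   _ {[]}    _ _ = z≤n
count-factored-roots a κ x₀ g@(suc _) g∣a a∣ {zs@(z ∷ _)} uniq all@((_ , g∣z-x₀ , a∣g[z+x₀]) ∷ _) =
  subst (length zs ℕ.≤_) (sym (hit-∣ t ℤ.∣ κ ∣ tt∣4κ))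
    (congruent-count t (lcm g h) uniq
      (All.map (λ { ((1≤z , z≤a) , _) → 1≤z , subst (_ ℕ.≤_) (sym t*lcm≡a) z≤a }) all)
      λ x∈ y∈ → ℤ∣.∣ᵤ⇒∣ (lcm-least (ℤ∣.∣⇒∣ᵤ (g∣x-y x∈ y∈)) (ℤ∣.∣⇒∣ᵤ (h∣x-y x∈ y∈))))
  where
  h = a ℕ./ g
  t = gcd g h
  g*h≡a : g ℕ.* h ≡ a
  g*h≡a = trans (ℕ.*-comm g h) (m/n*n≡m g∣a)
  t*lcm≡a : t ℕ.* lcm g h ≡ a
  t*lcm≡a = trans (gcd*lcm g h) g*h≡a

  h∣ : ∀ {u} → + a ∣ᶻ + g ℤ.* u → + h ∣ᶻ u
  h∣ {u} p = ℤ∣.*-cancelˡ-∣ (+ g)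
    (subst (_∣ᶻ + g ℤ.* u) (trans (cong +_ (sym g*h≡a)) (ℤ.pos-* g h)) p)

  sub₁ : ∀ x y c → (x ℤ.- c) ℤ.- (y ℤ.- c) ≡ x ℤ.- y
  sub₁ = ℤR.solve-∀
  sub₂ : ∀ x y c → (x ℤ.+ c) ℤ.- (y ℤ.+ c) ≡ x ℤ.- y
  sub₂ = ℤR.solve-∀
  sub₃ : ∀ x c → (x ℤ.+ c) ℤ.- (x ℤ.- c) ≡ + 2 ℤ.* c
  sub₃ = ℤR.solve-∀
  sub₄ : ∀ c k → (+ 2 ℤ.* c) ℤ.* (+ 2 ℤ.* c) ℤ.- + 4 ℤ.* (c ℤ.* c ℤ.- k) ≡ + 4 ℤ.* k
  sub₄ = ℤR.solve-∀

  g∣x-y : ∀ {x y} → x ∈ zs → y ∈ zs → + g ∣ᶻ + x ℤ.- + y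
  g∣x-y {x} {y} x∈ y∈ = subst (+ g ∣ᶻ_) (sub₁ (+ x) (+ y) x₀)
    (ℤ∣.∣m∣n⇒∣m-n (proj₁ (proj₂ (All.lookup all x∈))) (proj₁ (proj₂ (All.lookup all y∈))))
  h∣x-y : ∀ {x y} → x ∈ zs → y ∈ zs → + h ∣ᶻ + x ℤ.- + y
  h∣x-y {x} {y} x∈ y∈ = subst (+ h ∣ᶻ_) (sub₂ (+ x) (+ y) x₀)
    (ℤ∣.∣m∣n⇒∣m-n (h∣ (proj₂ (proj₂ (All.lookup all x∈)))) (h∣ (proj₂ (proj₂ (All.lookup all y∈)))))

  t∣2x₀ : + t ∣ᶻ + 2 ℤ.* x₀
  t∣2x₀ = subst (+ t ∣ᶻ_) (sub₃ (+ z) x₀) (ℤ∣.∣m∣n⇒∣m-n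
    (ℤ∣.∣-trans (ℤ∣.∣ᵤ⇒∣ (gcd[m,n]∣n g h)) (h∣ a∣g[z+x₀]))
    (ℤ∣.∣-trans (ℤ∣.∣ᵤ⇒∣ (gcd[m,n]∣m g h)) g∣z-x₀))
  square-∣ : ∀ u → + t ∣ᶻ u → + (t ℕ.* t) ∣ᶻ u ℤ.* u
  square-∣ u p = ℤ∣.∣ᵤ⇒∣ (subst (t ℕ.* t ∣ⁿ_) (sym (ℤ.abs-* u u))
    (ℕ∣.*-pres-∣ (ℤ∣.∣⇒∣ᵤ p) (ℤ∣.∣⇒∣ᵤ p)))
  tt∣a : + (t ℕ.* t) ∣ᶻ + a
  tt∣a = ℤ∣.∣ᵤ⇒∣ (subst (t ℕ.* t ∣ⁿ_) g*h≡a (ℕ∣.*-pres-∣ (gcd[m,n]∣m g h) (gcd[m,n]∣n g h)))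
  tt∣4κ : t ℕ.* t ∣ⁿ 4 ℕ.* ℤ.∣ κ ∣
  tt∣4κ = subst (t ℕ.* t ∣ⁿ_) (ℤ.abs-* (+ 4) κ) (ℤ∣.∣⇒∣ᵤ (subst (+ (t ℕ.* t) ∣ᶻ_) (sub₄ x₀ κ)
    (ℤ∣.∣m∣n⇒∣m-n (square-∣ _ t∣2x₀) (ℤ∣.∣n⇒∣m*n (+ 4) (ℤ∣.∣-trans tt∣a a∣)))))

-- Relative to a fixed root x₀, each root z factors a as gcd(z - x₀, a) times a divisor of z + x₀.
count-roots : ∀ a .{{_ : NonZero a}} κ {zs} → Unique zs →
  All (λ z → InRange a z × + a ∣ᶻ + z ℤ.* + z ℤ.- κ) zs →
  length zs ℕ.≤ sum (map (λ g → hit (common a g) ℤ.∣ κ ∣) (divisors a))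
count-roots a κ {[]} _ _ = z≤n
count-roots a κ {x₀ ∷ _} uniq all@((_ , a∣x₀²-κ) ∷ _) =
  length≤sum-fibres {P = InRange a}
    (λ z g → (+ g ℤ∣.∣? + z ℤ.- + x₀) ×-dec (+ a ℤ∣.∣? + g ℤ.* (+ z ℤ.+ + x₀)))
    (λ g → hit (common a g) ℤ.∣ κ ∣) (divisors a)
    (λ {g} g∈ → count-factored-roots a κ (+ x₀) g (proj₂ (∈-filter⁻ (_∣? a) {xs = applyUpTo suc a} g∈)) a∣x₀²-κ)
    uniq (All.map (λ { {z} (range , a∣z²-κ) → range , label z a∣z²-κ }) all)
  where
  factor : ∀ x y k → (x ℤ.* x ℤ.- k) ℤ.- (y ℤ.* y ℤ.- k) ≡ (x ℤ.- y) ℤ.* (x ℤ.+ y)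
  factor = ℤR.solve-∀
  label : ∀ z → + a ∣ᶻ + z ℤ.* + z ℤ.- κ →
    Any (λ g → + g ∣ᶻ + z ℤ.- + x₀ × + a ∣ᶻ + g ℤ.* (+ z ℤ.+ + x₀)) (divisors a)
  label z a∣z²-κ = lose (∈-divisors (gcd[m,n]∣n ℤ.∣ u ∣ a))
    (ℤ∣.∣ᵤ⇒∣ (gcd[m,n]∣m ℤ.∣ u ∣ a) ,
     ℤ∣.∣ᵤ⇒∣ (subst (a ∣ⁿ_) (sym (ℤ.abs-* (+ g) v)) (∣*⇒∣gcd* ℤ.∣ u ∣ ℤ.∣ v ∣
       (subst (a ∣ⁿ_) (ℤ.abs-* u v) (ℤ∣.∣⇒∣ᵤ a∣uv)))))
    where
    u = + z ℤ.- + x₀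
    v = + z ℤ.+ + x₀
    g = gcd ℤ.∣ u ∣ a
    a∣uv : + a ∣ᶻ u ℤ.* v
    a∣uv = subst (+ a ∣ᶻ_) (factor (+ z) (+ x₀) κ) (ℤ∣.∣m∣n⇒∣m-n a∣z²-κ a∣x₀²-κ)

-- Summation over the residues

-- As k runs up to K, each k with t² ∣ 4k raises the floor of 4k/t² by at least one. There are thus
-- at most 4K/t² of them, and each contributes t ≤ t².
sum-hits≤ : ∀ t .{{_ : NonZero t}} K → sum (map (λ k → hit t (suc k)) (upTo K)) ℕ.≤ 4 ℕ.* K
sum-hits≤ t K = begin
  sum (map (λ k → hit t (suc k)) (upTo K))   ≤⟨ sum-hits≤quotient K ⟩
  (4 ℕ.* K) ℕ./ T ℕ.* t                      ≤⟨ ℕ.*-monoʳ-≤ ((4 ℕ.* K) ℕ./ T) (ℕ.m≤m*n t t) ⟩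
  (4 ℕ.* K) ℕ./ T ℕ.* T                      ≤⟨ m/n*n≤m (4 ℕ.* K) T ⟩
  4 ℕ.* K                                    ∎
  where
  open ℕ.≤-Reasoning
  T = t ℕ.* t
  instance
    T≢0 : NonZero T
    T≢0 = ℕ.m*n≢0 t t

  step : ∀ K → (4 ℕ.* K) ℕ./ T ℕ.* t ℕ.+ hit t (suc K) ℕ.≤ (4 ℕ.* suc K) ℕ./ T ℕ.* t
  step K with T ∣? 4 ℕ.* suc K
  ... | no _ = subst (ℕ._≤ (4 ℕ.* suc K) ℕ./ T ℕ.* t) (sym (ℕ.+-identityʳ _))
    (ℕ.*-monoˡ-≤ t (/-monoˡ-≤ T (ℕ.*-monoʳ-≤ 4 (ℕ.n≤1+n K))))
  -- Here 4(K + 1) is an exact multiple of T and 4K lies strictly below it, so the quotient jumps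
  -- and pays for the new term t.
  ... | yes T∣ = subst (ℕ._≤ (4 ℕ.* suc K) ℕ./ T ℕ.* t) (ℕ.+-comm t _)
    (ℕ.*-monoˡ-≤ t (m<n*o⇒m/o<n {4 ℕ.* K} {(4 ℕ.* suc K) ℕ./ T} {T}
      (subst (4 ℕ.* K ℕ.<_) (sym (m/n*n≡m T∣)) (ℕ.*-monoʳ-< 4 (ℕ.n<1+n K)))))

  sum-hits≤quotient : ∀ K → sum (map (λ k → hit t (suc k)) (upTo K)) ℕ.≤ (4 ℕ.* K) ℕ./ T ℕ.* t
  sum-hits≤quotient zero    = z≤n
  sum-hits≤quotient (suc K) = begin
    sum (map f (upTo (suc K)))              ≡⟨ cong (sum ∘ map f) (List.upTo-∷ʳ K) ⟨
    sum (map f (upTo K ++ K ∷ []))          ≡⟨ cong sum (List.map-++ f (upTo K) (K ∷ [])) ⟩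
    sum (map f (upTo K) ++ f K ∷ [])        ≡⟨ sum-++ (map f (upTo K)) (f K ∷ []) ⟩
    sum (map f (upTo K)) ℕ.+ (f K ℕ.+ 0)    ≡⟨ cong (sum (map f (upTo K)) ℕ.+_) (ℕ.+-identityʳ (f K)) ⟩
    sum (map f (upTo K)) ℕ.+ f K            ≤⟨ ℕ.+-monoˡ-≤ (f K) (sum-hits≤quotient K) ⟩
    (4 ℕ.* K) ℕ./ T ℕ.* t ℕ.+ f K           ≤⟨ step K ⟩
    (4 ℕ.* suc K) ℕ./ T ℕ.* t               ∎
    where f = λ k → hit t (suc k)

-- The z are sorted by residue κ with |κ| ≤ K. The residue 0 contributes r; k and -k share one
-- bound, whence the factor 2. Exchanging the sums over k and g leaves at most 4K for each of the
-- d(a) divisors.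
count-near-squares : ∀ a .{{_ : NonZero a}} {r} → IsSquarePart r a → ∀ K {zs} → Unique zs →
  All (λ z → InRange a z × ∃[ κ ] (ℤ.∣ κ ∣ ℕ.≤ K × + a ∣ᶻ + z ℤ.* + z ℤ.- κ)) zs →
  length zs ℕ.≤ r ℕ.+ 2 ℕ.* (d a ℕ.* (4 ℕ.* K))
count-near-squares a {r} sp K {zs} uniq all = begin
  length zs
    ≤⟨ length≤sum-fibres {P = InRange a} (λ z κ → + a ℤ∣.∣? + z ℤ.* + z ℤ.- κ) bound residues
         (λ {κ} _ → fibre κ) uniq (All.map (λ { {z} (range , κ , κ≤K , a∣) → range , lose (∈-residues κ κ≤K) a∣ }) all) ⟩
  r ℕ.+ sum (map bound (map +[1+_] (upTo K) ++ map -[1+_] (upTo K)))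
    ≡⟨ cong (λ k → r ℕ.+ k) (trans (cong sum (List.map-++ bound (map +[1+_] (upTo K)) (map -[1+_] (upTo K))))
         (trans (sum-++ (map bound (map +[1+_] (upTo K))) _)
         (cong₂ ℕ._+_ (cong sum (sym (List.map-∘ (upTo K))))
           (trans (cong sum (sym (List.map-∘ (upTo K)))) (sym (ℕ.+-identityʳ _)))))) ⟩
  r ℕ.+ 2 ℕ.* sum (map (λ k → hits (suc k)) (upTo K))
    ≡⟨ cong (λ k → r ℕ.+ 2 ℕ.* k) (sum-swap (λ k g → hit (common a g) (suc k)) (upTo K) (divisors a)) ⟩
  r ℕ.+ 2 ℕ.* sum (map (λ g → sum (map (λ k → hit (common a g) (suc k)) (upTo K))) (divisors a))
    ≤⟨ ℕ.+-monoʳ-≤ r (ℕ.*-monoʳ-≤ 2 (sum-map≤ _ (4 ℕ.* K) (divisors a)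
         λ g → sum-hits≤ (common a g) {{common≢0 a g}} K)) ⟩
  r ℕ.+ 2 ℕ.* (d a ℕ.* (4 ℕ.* K)) ∎
  where
  open ℕ.≤-Reasoning
  hits : ℕ → ℕ
  hits k = sum (map (λ g → hit (common a g) k) (divisors a))
  bound : ℤ → ℕ
  bound (+ zero) = r
  bound +[1+ k ] = hits (suc k)
  bound -[1+ k ] = hits (suc k)
  residues : List ℤ
  residues = + 0 ∷ map +[1+_] (upTo K) ++ map -[1+_] (upTo K)
  ∈-residues : ∀ κ → ℤ.∣ κ ∣ ℕ.≤ K → κ ∈ residues
  ∈-residues (+ zero) _   = here refl
  ∈-residues +[1+ k ] k<K = there (∈-++⁺ˡ (∈-map⁺ +[1+_] (∈-upTo⁺ k<K)))
  ∈-residues -[1+ k ] k<K = there (∈-++⁺ʳ (map +[1+_] (upTo K)) (∈-map⁺ -[1+_] (∈-upTo⁺ k<K)))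
  fibre : ∀ κ {zs} → Unique zs → All (λ z → InRange a z × + a ∣ᶻ + z ℤ.* + z ℤ.- κ) zs →
    length zs ℕ.≤ bound κ
  fibre (+ zero) u all = count-square≡0 a sp u (All.map (λ { {z} (range , a∣) → range ,
    subst (a ∣ⁿ_) (trans (cong ℤ.∣_∣ (ℤ.+-identityʳ (+ z ℤ.* + z))) (ℤ.abs-* (+ z) (+ z))) (ℤ∣.∣⇒∣ᵤ a∣) }) all)
  fibre +[1+ k ] = count-roots a +[1+ k ]
  fibre -[1+ k ] = count-roots a -[1+ k ]

-- Passage to the reals

toℚᵘ-/ : ∀ i n → ℚ.toℚᵘ (i ℚ./ suc n) ℚᵘ.≃ ℚᵘ.mkℚᵘ i n
toℚᵘ-/ i n = ℚ.toℚᵘ-fromℚᵘ (ℚᵘ.mkℚᵘ i n)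

fromℤ-* : ∀ i j → fromℤ (i ℤ.* j) ≡ fromℤ i ℚ.* fromℤ j
fromℤ-* i j = ℚ.toℚᵘ-injective
  (ℚᵘ.≃-trans (toℚᵘ-/ (i ℤ.* j) 0)
  (ℚᵘ.≃-sym (ℚᵘ.≃-trans (ℚ.toℚᵘ-homo-* (fromℤ i) (fromℤ j)) (ℚᵘ.*-cong (toℚᵘ-/ i 0) (toℚᵘ-/ j 0)))))

fromℤ-pos-* : ∀ m n → fromℤ (+ (m ℕ.* n)) ≡ fromℤ (+ m) ℚ.* fromℤ (+ n)
fromℤ-pos-* m n = trans (cong fromℤ (ℤ.pos-* m n)) (fromℤ-* (+ m) (+ n))

fromℤ≥0 : ∀ n → 0ℚ ℚ.≤ fromℤ (+ n)
fromℤ≥0 n = Floor.fromℤ-mono {+ 0} {+ n} (ℤ.+≤+ z≤n)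

fromℤ-/ : ∀ i n .{{_ : NonZero n}} → fromℤ i ≡ fromℤ (+ n) ℚ.* (i ℚ./ n)
fromℤ-/ i (suc n) = ℚ.toℚᵘ-injective
  (ℚᵘ.≃-trans (toℚᵘ-/ i 0)
  (ℚᵘ.≃-trans (ℚᵘ.*≡* (rotate i (+ suc n)))
  (ℚᵘ.≃-sym (ℚᵘ.≃-trans (ℚ.toℚᵘ-homo-* (fromℤ (+ suc n)) (i ℚ./ suc n))
    (ℚᵘ.*-cong (toℚᵘ-/ (+ suc n) 0) (toℚᵘ-/ i n))))))
  where
  rotate : ∀ i n → i ℤ.* (+ 1 ℤ.* n) ≡ (n ℤ.* i) ℤ.* + 1
  rotate = ℤR.solve-∀

∣/-fromℤ∣ : ∀ i m n .{{_ : NonZero n}} →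
  ℚ.∣ i ℚ./ n ℚ.- fromℤ m ∣ ≡ + ℤ.∣ i ℤ.- m ℤ.* + n ∣ ℚ./ n
∣/-fromℤ∣ i m (suc n) = ℚ.toℚᵘ-injective
  (ℚᵘ.≃-trans (ℚ.toℚᵘ-homo-∣-∣ (i ℚ./ suc n ℚ.- fromℤ m))
  (ℚᵘ.≃-trans (ℚᵘ.∣-∣-cong
    (ℚᵘ.≃-trans (ℚ.toℚᵘ-homo-+ (i ℚ./ suc n) (ℚ.- fromℤ m))
    (ℚᵘ.≃-trans (ℚᵘ.+-cong (toℚᵘ-/ i n)
      (ℚᵘ.≃-trans (ℚ.toℚᵘ-homo‿- (fromℤ m)) (ℚᵘ.-‿cong (toℚᵘ-/ m 0))))
      (ℚᵘ.*≡* {q = ℚᵘ.mkℚᵘ (i ℤ.- m ℤ.* + suc n) n} (common-denominator i m (+ suc n))))))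
    (ℚᵘ.≃-sym (toℚᵘ-/ (+ ℤ.∣ i ℤ.- m ℤ.* + suc n ∣) n))))
  where
  common-denominator : ∀ i m n →
    (i ℤ.* + 1 ℤ.+ (ℤ.- m) ℤ.* n) ℤ.* n ≡ (i ℤ.- m ℤ.* n) ℤ.* (n ℤ.* + 1)
  common-denominator = ℤR.solve-∀

-- With m an integer nearest to n/a, the residue is κ = n - m a, and |n/a - m| = |κ|/a.
‖/‖-residue : ∀ n a .{{_ : NonZero a}} →
  ∃[ κ ] (‖ + n ℚ./ a ‖ ≡ + ℤ.∣ κ ∣ ℚ./ a × + a ∣ᶻ + n ℤ.- κ)
‖/‖-residue n a with ‖‖-attained (+ n ℚ./ a)
... | m , eq = + n ℤ.- m ℤ.* + a , trans eq (∣/-fromℤ∣ (+ n) m a) ,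
  ℤ∣.divides m (cancel (+ n) (m ℤ.* + a))
  where
  cancel : ∀ x y → x ℤ.- (x ℤ.- y) ≡ y
  cancel = ℤR.solve-∀

-- Real inequalities are verified on late terms of the sequences, so positivity of δ is needed in
-- the form of nonnegative terms.
positive⇒eventually≥0 : ∀ {x} → 0ℝ < x → ∃[ N ] (∀ n → N ℕ.≤ n → 0ℚ ℚ.≤ seq x n)
positive⇒eventually≥0 {x} (ε , 0<ε , N , h) = N , λ n N≤n →
  ℚ.≤-trans (ℚ.<⇒≤ 0<ε) (subst (ℚ._≤ seq x n) (ℚ.+-identityˡ ε) (h n N≤n))

-- Taking for K the largest residue that occurs makes floor(δ a), which is not computable, unnecessary.
largest-residue : ∀ a .{{_ : NonZero a}} {δ} → 0ℝ < δ → ∀ {zs} → All (Counted a δ) zs →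
  ∃[ K ] (fromℚ (+ K ℚ./ a) ≤ δ ×
    All (λ z → InRange a z × ∃[ κ ] (ℤ.∣ κ ∣ ℕ.≤ K × + a ∣ᶻ + z ℤ.* + z ℤ.- κ)) zs)
largest-residue a {δ} 0<δ [] =
  0 , subst (λ q → fromℚ q ≤ δ) (sym (ℚ.0/n≡0 a)) 0≤δ , []
  where
  0≤δ : 0ℝ ≤ δ
  0≤δ ε 0<ε = let (N , δ≥0) = positive⇒eventually≥0 {δ} 0<δ in
    N , λ n N≤n → ℚ.+-mono-≤ (δ≥0 n N≤n) (ℚ.<⇒≤ 0<ε)
largest-residue a {δ} 0<δ {z ∷ zs} ((1≤z , z≤a , near) ∷ rest) =
  extend (largest-residue a {δ} 0<δ rest) (‖/‖-residue (z ℕ.* z) a)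
  where
  Near : ℕ → ℕ → Set
  Near K z = InRange a z × ∃[ κ ] (ℤ.∣ κ ∣ ℕ.≤ K × + a ∣ᶻ + z ℤ.* + z ℤ.- κ)
  weaken : ∀ {K K′ z} → K ℕ.≤ K′ → Near K z → Near K′ z
  weaken K≤K′ (range , κ , κ≤K , a∣) = range , κ , ℕ.≤-trans κ≤K K≤K′ , a∣
  extend : ∃[ K ] (fromℚ (+ K ℚ./ a) ≤ δ × All (Near K) zs) →
    ∃[ κ ] (‖ + (z ℕ.* z) ℚ./ a ‖ ≡ + ℤ.∣ κ ∣ ℚ./ a × + a ∣ᶻ + (z ℕ.* z) ℤ.- κ) →
    ∃[ K ] (fromℚ (+ K ℚ./ a) ≤ δ × All (Near K) (z ∷ zs))
  extend (K , K≤δ , all) (κ , eq , a∣) = choose (ℕ.≤-total ℤ.∣ κ ∣ K)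
    where
    a∣z²-κ : + a ∣ᶻ + z ℤ.* + z ℤ.- κ
    a∣z²-κ = subst (λ s → + a ∣ᶻ s ℤ.- κ) (ℤ.pos-* z z) a∣
    choose : ℤ.∣ κ ∣ ℕ.≤ K ⊎ K ℕ.≤ ℤ.∣ κ ∣ → ∃[ K ] (fromℚ (+ K ℚ./ a) ≤ δ × All (Near K) (z ∷ zs))
    choose (inj₁ κ≤K) = K , K≤δ , ((1≤z , z≤a) , κ , κ≤K , a∣z²-κ) ∷ all
    -- A larger residue takes over as K; the membership condition of z itself says that |κ|/a ≤ δ.
    choose (inj₂ K≤κ) = ℤ.∣ κ ∣ , subst (λ q → fromℚ q ≤ δ) eq near ,
      ((1≤z , z≤a) , κ , ℕ.≤-refl , a∣z²-κ) ∷ All.map (weaken K≤κ) all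

-- Lower bounds for the logarithm

Σ<-nonneg : ∀ n f → (∀ i → 0ℚ ℚ.≤ f i) → 0ℚ ℚ.≤ Σ< n f
Σ<-nonneg zero    f h = ℚ.≤-refl
Σ<-nonneg (suc n) f h = ℚ.+-mono-≤ (Σ<-nonneg n f h) (h n)

riemannSum≥0 : ∀ a n → 0ℚ ℚ.≤ riemannSum a (suc n)
riemannSum≥0 a n = Σ<-nonneg ((a ℕ.∸ 1) ℕ.* suc n) _ (λ i → Rat.0≤1/ (suc n ℕ.+ suc i))

-- The part of the sum over [1 , 2] has N = n + 1 terms, each at least 1/(2N).
½≤riemannSum : ∀ b n → ℚ.½ ℚ.≤ riemannSum (suc (suc b)) (suc n)
½≤riemannSum b n = begin
  ℚ.½                                                ≡⟨ Riemann.times-cancel n 1 ⟨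
  Σ< N (λ _ → (+ 1) ℚ./ (2 ℕ.* N))                    ≤⟨ Riemann.Σ<-mono N _ f term≥ ⟩
  Σ< N f                                             ≡⟨ ℚ.+-identityʳ (Σ< N f) ⟨
  Σ< N f ℚ.+ 0ℚ                                      ≤⟨ ℚ.+-monoʳ-≤ (Σ< N f)
                                                          (Σ<-nonneg (b ℕ.* N) _ λ j → Rat.0≤1/ (N ℕ.+ suc (N ℕ.+ j))) ⟩
  Σ< N f ℚ.+ Σ< (b ℕ.* N) (λ j → f (N ℕ.+ j))        ≡⟨ Riemann.Σ<-++ N (b ℕ.* N) f ⟨
  Σ< (N ℕ.+ b ℕ.* N) f                               ∎
  where
  open ℚ.≤-Reasoning
  N = suc n
  f : ℕ → ℚ
  f i = (+ 1) ℚ./ (N ℕ.+ suc i)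
  term≥ : ∀ i → i ℕ.< N → (+ 1) ℚ./ (2 ℕ.* N) ℚ.≤ f i
  term≥ i i<N = Rat./-anti-≤ (ℕ.+-monoʳ-≤ N (subst (suc i ℕ.≤_) (sym (ℕ.+-identityʳ N)) i<N))

-- The final estimate

*-nonneg : ∀ {p q} → 0ℚ ℚ.≤ p → 0ℚ ℚ.≤ q → 0ℚ ℚ.≤ p ℚ.* q
*-nonneg {p} {q} 0≤p 0≤q = subst (ℚ._≤ p ℚ.* q) (ℚ.*-zeroʳ p)
  (ℚ.*-monoˡ-≤-nonNeg p {{ℚ.nonNegative 0≤p}} 0≤q)

-- Raising the coefficient of S from 1 to 16 only enlarges the sum. T stands for the main term and S
-- for σ(r), so one constant covers both.
≤16* : ∀ {T S ε} → 0ℚ ℚ.≤ T → 0ℚ ℚ.≤ S → 0ℚ ℚ.≤ ε →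
  S ℚ.+ fromℤ (+ 16) ℚ.* T ℚ.+ ε ℚ.≤ fromℤ (+ 16) ℚ.* ℚ.∣ T ℚ.+ S ∣ ℚ.+ ε
≤16* {T} {S} {ε} 0≤T 0≤S 0≤ε = begin
  S ℚ.+ fromℤ (+ 16) ℚ.* T ℚ.+ ε
    ≡⟨ solve 3 (λ T S ε → S :+ con (fromℤ (+ 16)) :* T :+ ε := con (fromℤ (+ 16)) :* T :+ S :+ con 0ℚ :+ ε) refl T S ε ⟩
  fromℤ (+ 16) ℚ.* T ℚ.+ S ℚ.+ 0ℚ ℚ.+ ε
    ≤⟨ ℚ.+-monoˡ-≤ ε (ℚ.+-monoʳ-≤ (fromℤ (+ 16) ℚ.* T ℚ.+ S) (*-nonneg (fromℤ≥0 15) 0≤S)) ⟩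
  fromℤ (+ 16) ℚ.* T ℚ.+ S ℚ.+ fromℤ (+ 15) ℚ.* S ℚ.+ ε
    ≡⟨ solve 3 (λ T S ε → con (fromℤ (+ 16)) :* T :+ S :+ con (fromℤ (+ 15)) :* S :+ ε :=
                          con (fromℤ (+ 16)) :* (T :+ S) :+ ε) refl T S ε ⟩
  fromℤ (+ 16) ℚ.* (T ℚ.+ S) ℚ.+ ε
    ≤⟨ ℚ.+-monoˡ-≤ ε (ℚ.*-monoˡ-≤-nonNeg (fromℤ (+ 16)) (Rat.p≤∣p∣ (T ℚ.+ S))) ⟩
  fromℤ (+ 16) ℚ.* ℚ.∣ T ℚ.+ S ∣ ℚ.+ ε ∎
  where
  open ℚ.≤-Reasoning
  open +-*-Solver using (solve; _:+_; _:*_; _:=_; con)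

-- The inequality for one term of the sequences, with κ = K/a and L a Riemann sum for log a. Since ½
-- ≤ L, 8 δ A D is at most 16 δ A L D, which is where the constant 16 comes from. The error η,
-- multiplied by 8 D A, uses up half of ε.
final-estimate : ∀ {δ A L D S κ η ε M} → 0ℚ ℚ.≤ δ → 0ℚ ℚ.≤ A → 0ℚ ℚ.≤ D → 0ℚ ℚ.≤ S → 0ℚ ℚ.≤ ε →
  ℚ.½ ℚ.≤ L → κ ℚ.≤ δ ℚ.+ η → fromℤ (+ 8) ℚ.* (D ℚ.* A) ℚ.* η ≡ ℚ.½ ℚ.* ε →
  M ℚ.≤ S ℚ.+ fromℤ (+ 8) ℚ.* (D ℚ.* A) ℚ.* κ →
  M ℚ.≤ fromℤ (+ 16) ℚ.* ℚ.∣ δ ℚ.* A ℚ.* L ℚ.* D ℚ.+ S ∣ ℚ.+ ε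
final-estimate {δ} {A} {L} {D} {S} {κ} {η} {ε} {M} 0≤δ 0≤A 0≤D 0≤S 0≤ε ½≤L κ≤ Bη≡ M≤ = begin
  M                                            ≤⟨ M≤ ⟩
  S ℚ.+ B ℚ.* κ                                ≤⟨ ℚ.+-monoʳ-≤ S (ℚ.*-monoˡ-≤-nonNeg B {{ℚ.nonNegative 0≤B}} κ≤) ⟩
  S ℚ.+ B ℚ.* (δ ℚ.+ η)                        ≡⟨ cong (S ℚ.+_) (ℚ.*-distribˡ-+ B δ η) ⟩
  S ℚ.+ (B ℚ.* δ ℚ.+ B ℚ.* η)                  ≡⟨ cong (λ q → S ℚ.+ (B ℚ.* δ ℚ.+ q)) Bη≡ ⟩
  S ℚ.+ (B ℚ.* δ ℚ.+ ℚ.½ ℚ.* ε)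
    ≡⟨ solve 5 (λ S D A δ ε →
         S :+ (con (fromℤ (+ 8)) :* (D :* A) :* δ :+ con ℚ.½ :* ε) :=
         S :+ con (fromℤ (+ 16)) :* (δ :* A :* D :* con ℚ.½) :+ con ℚ.½ :* ε :+ con 0ℚ) refl S D A δ ε ⟩
  S ℚ.+ fromℤ (+ 16) ℚ.* (δ ℚ.* A ℚ.* D ℚ.* ℚ.½) ℚ.+ ℚ.½ ℚ.* ε ℚ.+ 0ℚ
    ≤⟨ ℚ.+-mono-≤ (ℚ.+-monoˡ-≤ (ℚ.½ ℚ.* ε) (ℚ.+-monoʳ-≤ S (ℚ.*-monoˡ-≤-nonNeg (fromℤ (+ 16))
         (ℚ.*-monoˡ-≤-nonNeg (δ ℚ.* A ℚ.* D) {{ℚ.nonNegative 0≤δAD}} ½≤L))))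
         (*-nonneg (ℚ.<⇒≤ (ℚ.positive⁻¹ ℚ.½)) 0≤ε) ⟩
  S ℚ.+ fromℤ (+ 16) ℚ.* (δ ℚ.* A ℚ.* D ℚ.* L) ℚ.+ ℚ.½ ℚ.* ε ℚ.+ ℚ.½ ℚ.* ε
    ≡⟨ solve 6 (λ S D A L δ ε →
         S :+ con (fromℤ (+ 16)) :* (δ :* A :* D :* L) :+ con ℚ.½ :* ε :+ con ℚ.½ :* ε :=
         S :+ con (fromℤ (+ 16)) :* (δ :* A :* L :* D) :+ ε) refl S D A L δ ε ⟩
  S ℚ.+ fromℤ (+ 16) ℚ.* (δ ℚ.* A ℚ.* L ℚ.* D) ℚ.+ ε
    ≤⟨ ≤16* (*-nonneg (*-nonneg (*-nonneg 0≤δ 0≤A) (ℚ.≤-trans (ℚ.<⇒≤ (ℚ.positive⁻¹ ℚ.½)) ½≤L)) 0≤D) 0≤S 0≤ε ⟩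
  fromℤ (+ 16) ℚ.* ℚ.∣ δ ℚ.* A ℚ.* L ℚ.* D ℚ.+ S ∣ ℚ.+ ε ∎
  where
  open ℚ.≤-Reasoning
  open +-*-Solver using (solve; _:+_; _:*_; _:=_; con)
  B = fromℤ (+ 8) ℚ.* (D ℚ.* A)
  0≤B : 0ℚ ℚ.≤ B
  0≤B = *-nonneg (fromℤ≥0 8) (*-nonneg 0≤D 0≤A)
  0≤δAD : 0ℚ ℚ.≤ δ ℚ.* A ℚ.* D
  0≤δAD = *-nonneg (*-nonneg 0≤δ 0≤A) 0≤D

fromℤ>0 : ∀ n → 1 ℕ.≤ n → 0ℚ ℚ.< fromℤ (+ n)
fromℤ>0 (suc n) _ = ℚ.positive⁻¹ (fromℤ (+ suc n)) {{ℚ.normalize-pos (suc n) 1}}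

r≤σr : ∀ {r a} → IsSquarePart r a → r ℕ.≤ σ r
r≤σr sp = ∈⇒≤sum (∈-divisors {{ℕ.>-nonZero (squarePart>0 sp)}} ℕ∣.∣-refl)

-- The logarithm vanishes at 1, so σ(r) has to carry the bound: N ≤ 1 ≤ r ≤ σ(r), and the other term
-- is nonnegative.
bound-at-1 : ∀ r δ → IsSquarePart r 1 → 0ℝ < δ → ∀ N → N ℕ.≤ 1 →
  ∣ fromℕ N ∣ ≤ fromℕ 16 * ∣ δ * fromℕ 1 * log 1 * fromℕ (d 1) + fromℕ (σ r) ∣
bound-at-1 r δ sp 0<δ N N≤1 ε 0<ε = let (N₁ , δ≥0) = positive⇒eventually≥0 {δ} 0<δ in
  N₁ , λ n N₁≤n → estimate n (δ≥0 n N₁≤n)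
  where
  open ℚ.≤-Reasoning
  S = fromℤ (+ σ r)
  estimate : ∀ n → 0ℚ ℚ.≤ seq δ n →
    ℚ.∣ fromℤ (+ N) ∣ ℚ.≤ fromℤ (+ 16) ℚ.*
      ℚ.∣ seq δ n ℚ.* fromℤ (+ 1) ℚ.* riemannSum 1 (suc n) ℚ.* fromℤ (+ d 1) ℚ.+ S ∣ ℚ.+ ε
  estimate n 0≤δₙ = begin
    ℚ.∣ fromℤ (+ N) ∣                    ≡⟨ ℚ.0≤p⇒∣p∣≡p (fromℤ≥0 N) ⟩
    fromℤ (+ N)                          ≤⟨ Floor.fromℤ-mono {+ N} {+ σ r}
                                              (ℤ.+≤+ (ℕ.≤-trans N≤1 (ℕ.≤-trans (squarePart>0 sp) (r≤σr sp)))) ⟩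
    S                                    ≡⟨ trans (ℚ.+-identityʳ _) (ℚ.+-identityʳ S) ⟨
    S ℚ.+ 0ℚ ℚ.+ 0ℚ                      ≤⟨ ℚ.+-mono-≤ (ℚ.+-monoʳ-≤ S (*-nonneg (fromℤ≥0 16) T≥0)) (ℚ.<⇒≤ 0<ε) ⟩
    S ℚ.+ fromℤ (+ 16) ℚ.* T ℚ.+ ε       ≤⟨ ≤16* T≥0 (fromℤ≥0 (σ r)) (ℚ.<⇒≤ 0<ε) ⟩
    fromℤ (+ 16) ℚ.* ℚ.∣ T ℚ.+ S ∣ ℚ.+ ε ∎
    where
    T = seq δ n ℚ.* fromℤ (+ 1) ℚ.* riemannSum 1 (suc n) ℚ.* fromℤ (+ d 1)
    T≥0 : 0ℚ ℚ.≤ T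
    T≥0 = *-nonneg (*-nonneg (*-nonneg 0≤δₙ (fromℤ≥0 1)) (riemannSum≥0 1 n)) (fromℤ≥0 (d 1))

bound-above-1 : ∀ b r δ → let a = suc (suc b) in 0ℝ < δ → ∀ N K → fromℚ (+ K ℚ./ a) ≤ δ →
  N ℕ.≤ σ r ℕ.+ 2 ℕ.* (d a ℕ.* (4 ℕ.* K)) →
  ∣ fromℕ N ∣ ≤ fromℕ 16 * ∣ δ * fromℕ a * log a * fromℕ (d a) + fromℕ (σ r) ∣
bound-above-1 b r δ 0<δ N K K≤δ N≤ ε 0<ε =
  let (N₁ , δ≥0)      = positive⇒eventually≥0 {δ} 0<δ
      -- K/a ≤ δ holds termwise only up to an error. The tolerance η is chosen so that this error,
      -- once multiplied by B, equals ½ ε.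
      (η , 0<η , Bη≡) = Rat.scale B ε 0<B 0<ε
      (N₂ , κ≤)       = K≤δ η 0<η
  in N₁ ℕ.⊔ N₂ , λ n N≤n → subst
       (ℚ._≤ fromℤ (+ 16) ℚ.* ℚ.∣ seq δ n ℚ.* A ℚ.* riemannSum a (suc n) ℚ.* D ℚ.+ S ∣ ℚ.+ ε)
       (sym (ℚ.0≤p⇒∣p∣≡p (fromℤ≥0 N)))
       (final-estimate {seq δ n} {A} {riemannSum a (suc n)} {D} {S} {κ} {η} {ε} {fromℤ (+ N)}
         (δ≥0 n (ℕ.m⊔n≤o⇒m≤o N₁ N₂ N≤n)) (fromℤ≥0 a) (fromℤ≥0 (d a)) (fromℤ≥0 (σ r)) (ℚ.<⇒≤ 0<ε)
         (½≤riemannSum b n) (κ≤ n (ℕ.m⊔n≤o⇒n≤o N₁ N₂ N≤n)) Bη≡ N≤S+Bκ)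
  where
  a = suc (suc b)
  A = fromℤ (+ a)
  D = fromℤ (+ d a)
  S = fromℤ (+ σ r)
  κ = + K ℚ./ a
  B = fromℤ (+ 8) ℚ.* (D ℚ.* A)
  0<B : 0ℚ ℚ.< B
  -- B has to be inverted to obtain η; d(a) is positive because 1 divides a.
  0<B = Rat.0<* (fromℤ>0 8 (s≤s z≤n)) (Rat.0<*
    (fromℤ>0 (d a) (∈-length (∈-divisors {a} (ℕ∣.1∣ a)))) (fromℤ>0 a (s≤s z≤n)))
  regroup : ∀ d k → 2 ℕ.* (d ℕ.* (4 ℕ.* k)) ≡ 8 ℕ.* (d ℕ.* k)
  regroup = ℕR.solve-∀
  reassoc : ∀ e d a k → e ℚ.* (d ℚ.* (a ℚ.* k)) ≡ e ℚ.* (d ℚ.* a) ℚ.* k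
  reassoc = solve 4 (λ e d a k → e :* (d :* (a :* k)) := e :* (d :* a) :* k) refl
    where open +-*-Solver using (solve; _:*_; _:=_)
  N≤S+Bκ : fromℤ (+ N) ℚ.≤ S ℚ.+ B ℚ.* κ
  N≤S+Bκ = begin
    fromℤ (+ N)
      ≤⟨ Floor.fromℤ-mono {+ N} {+ (σ r ℕ.+ 2 ℕ.* (d a ℕ.* (4 ℕ.* K)))} (ℤ.+≤+ N≤) ⟩
    fromℤ (+ (σ r ℕ.+ 2 ℕ.* (d a ℕ.* (4 ℕ.* K))))
      ≡⟨ cong (λ k → fromℤ (+ (σ r ℕ.+ k))) (regroup (d a) K) ⟩
    fromℤ (+ (σ r ℕ.+ 8 ℕ.* (d a ℕ.* K)))
      ≡⟨ Riemann.addfrac (+ σ r) (+ (8 ℕ.* (d a ℕ.* K))) 0 ⟨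
    S ℚ.+ fromℤ (+ (8 ℕ.* (d a ℕ.* K)))
      ≡⟨ cong (S ℚ.+_) (trans (fromℤ-pos-* 8 (d a ℕ.* K)) (cong (fromℤ (+ 8) ℚ.*_)
           (trans (fromℤ-pos-* (d a) K) (cong (D ℚ.*_) (fromℤ-/ (+ K) a))))) ⟩
    S ℚ.+ fromℤ (+ 8) ℚ.* (D ℚ.* (A ℚ.* κ))
      ≡⟨ cong (S ℚ.+_) (reassoc (fromℤ (+ 8)) D A κ) ⟩
    S ℚ.+ B ℚ.* κ ∎
    where open ℚ.≤-Reasoning

theorem4 : Σ[ C ∈ ℝ ] (∀ (a : ℕ) .{{_ : NonZero a}} (r : ℕ) (δ : ℝ) →
    IsSquarePart r a → 0ℝ < δ → δ < ½ →
    ∀ (N : ℕ) → A[ a , δ ]≡ N →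
    ∣ fromℕ N ∣ ≤ C * ∣ δ * fromℕ a * log a * fromℕ (d a) + fromℕ (σ r) ∣)
theorem4 = fromℕ 16 , bound
  where
  bound : ∀ (a : ℕ) .{{_ : NonZero a}} (r : ℕ) (δ : ℝ) →
    IsSquarePart r a → 0ℝ < δ → δ < ½ →
    ∀ (N : ℕ) → A[ a , δ ]≡ N →
    ∣ fromℕ N ∣ ≤ fromℕ 16 * ∣ δ * fromℕ a * log a * fromℕ (d a) + fromℕ (σ r) ∣
  bound (suc zero) r δ sp 0<δ _ N (xs , uniq , mem , len) =
    bound-at-1 r δ sp 0<δ N (subst (ℕ._≤ 1) len (length≤1 uniq λ x∈ y∈ → trans (is1 x∈) (sym (is1 y∈))))
    where
    is1 : ∀ {x} → x ∈ xs → x ≡ 1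
    is1 x∈ = let (1≤x , x≤1 , _) = Equivalence.to (mem _) x∈ in ℕ.≤-antisym x≤1 1≤x
  bound a@(suc (suc b)) r δ sp 0<δ _ N (xs , uniq , mem , len) =
    let (K , K≤δ , near) = largest-residue a {δ} 0<δ {xs} (All.tabulate λ {x} → Equivalence.to (mem x))
    in bound-above-1 b r δ 0<δ N K K≤δ (subst (ℕ._≤ _) len
         (ℕ.≤-trans (count-near-squares a sp K uniq near) (ℕ.+-monoˡ-≤ _ (r≤σr sp))))
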